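{- There is a function $g:\mathbb{Z}_{\ge 0}\to\mathbb{R}$ with $g(\lambda)=o(\lambda)$ as $\lambda\to\infty$ such that for all integers $n\ge 1$ and $\lambda\ge 0$, $$ f(n,1,\lambda) \le \max\left\{ n+2,\; 8\min\left\{\lambda, \frac{n-\lambda}{3}\right\} + g(\lambda) \right\}. $$
   Context: Let $[n]=\{1,\dots,n\}$. For non-negative integers $k,\lambda$, a family (set of distinct subsets) $\mathcal{F}\subset 2^{[n]}$ is called $k$-almost $\lambda$-Fisher if for every $F\in\mathcal{F}$ there are at most $k$ other sets $F'\in\mathcal{F}\setminus\{F\}$ with $|F\cap F'|\neq\lambda$. Define $f(n,k,\lambda)=\max\{|\mathcal{F}| : \mathcal{F}\subset 2^{[n]} \text{ is a } k\text{ -almost } \lambda\text{ -Fisher family}\}$. -}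

module Defs where

open import Data.Bool.Properties using () renaming (_≟_ to _≟ᵇ_)
open import Data.Fin.Subset using (Subset; inside; outside; _∩_; ∣_∣)
open import Data.Integer.Base using (+_)
open import Data.List.Base using (List; []; _∷_; [_]; _++_; map; filter; length)
open import Data.List.Extrema.Nat using (max; v≤max⁺)
open import Data.List.Membership.Propositional using (_∈_; lose)
open import Data.List.Membership.Propositional.Properties
  using (∈-map⁺; ∈-map⁻; ∈-++⁺ˡ; ∈-++⁺ʳ; ∈-filter⁺; ∈-filter⁻)
open import Data.List.Membership.Propositional.Properties.WithK using (unique∧set⇒bag)
open import Data.List.Relation.Binary.BagAndSetEquality using (∼bag⇒↭)
open import Data.List.Relation.Binary.Permutation.Propositional using (_↭_; ↭-sym)
open import Data.List.Relation.Binary.Permutation.Propositional.Properties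
  using (↭-length; filter-↭; All-resp-↭)
open import Data.List.Relation.Unary.All as All using (All; []; _∷_; all?)
import Data.List.Relation.Unary.All.Properties as All
open import Data.List.Relation.Unary.AllPairs using ([]; _∷_)
open import Data.List.Relation.Unary.Any using (here)
open import Data.List.Relation.Unary.Unique.Propositional using (Unique)
import Data.List.Relation.Unary.Unique.Propositional.Properties as Unique
open import Data.Nat as ℕ using (ℕ; zero; suc)
import Data.Nat.Properties as ℕ
open import Data.Product using (∃; _×_; _,_; proj₁; proj₂)
open import Data.Rational as ℚ using (ℚ; 0ℚ; ½)
import Data.Rational.Properties as ℚ
open import Data.Rational.Solver using (module +-*-Solver)
open import Data.Sum using (inj₁; inj₂)
open import Data.Vec.Base using ([]; _∷_)
open import Data.Vec.Properties using (≡-dec; ∷-injectiveʳ)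
open import Function using (mk⇔; _∘_)
open import Relation.Binary.Definitions using (DecidableEquality)
open import Relation.Binary.PropositionalEquality
  using (_≡_; _≢_; refl; sym; trans; cong; subst)
open import Relation.Nullary using (yes; no; ¬?; _×-dec_)
open import Relation.Unary using (Decidable)
open +-*-Solver using (solve; _:=_; _:+_; :-_)

private variable
  n : ℕ
  A : Set

record Family (n : ℕ) : Set where
  constructor family
  field
    members  : List (Subset n)
    distinct : Unique members

open Family public

card : Family n → ℕ
card = length ∘ members

_≟ˢ_ : DecidableEquality (Subset n)
_≟ˢ_ = ≡-dec _≟ᵇ_

Exception : ℕ → Subset n → Subset n → Set
Exception l F F′ = F′ ≢ F × ∣ F ∩ F′ ∣ ≢ l

exception? : ∀ l (F : Subset n) → Decidable (Exception l F)
exception? l F F′ = ¬? (F′ ≟ˢ F) ×-dec ¬? (∣ F ∩ F′ ∣ ℕ.≟ l)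

AlmostFisher : ℕ → ℕ → List (Subset n) → Set
AlmostFisher k l 𝓕 = All (λ F → length (filter (exception? l F) 𝓕) ℕ.≤ k) 𝓕

almostFisher? : ∀ k l → Decidable (AlmostFisher {n} k l)
almostFisher? k l 𝓕 = all? (λ F → length (filter (exception? l F) 𝓕) ℕ.≤? k) 𝓕

allSubsets : ∀ n → List (Subset n)
allSubsets zero    = [ [] ]
allSubsets (suc n) = map (outside ∷_) (allSubsets n) ++ map (inside ∷_) (allSubsets n)

sublists : List A → List (List A)
sublists []       = [ [] ]
sublists (x ∷ xs) = map (x ∷_) (sublists xs) ++ sublists xs

-- Every family is, up to the order of its members, a sublist of allSubsets n;
-- f-isMaximum states that f n k l is the maximum over all families.
f : ℕ → ℕ → ℕ → ℕ
f n k l = max 0 (map length (filter (almostFisher? k l) (sublists (allSubsets n))))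

IsMaximum : (ℕ → Set) → ℕ → Set
IsMaximum P m = P m × (∀ j → P j → j ℕ.≤ m)

IsFisherSize : (n k l : ℕ) → ℕ → Set
IsFisherSize n k l m = ∃ λ (𝓕 : Family n) → AlmostFisher k l (members 𝓕) × card 𝓕 ≡ m

private
  allSubsets-complete : (F : Subset n) → F ∈ allSubsets n
  allSubsets-complete []            = here refl
  allSubsets-complete (outside ∷ F) = ∈-++⁺ˡ (∈-map⁺ _ (allSubsets-complete F))
  allSubsets-complete (inside  ∷ F) = ∈-++⁺ʳ _ (∈-map⁺ _ (allSubsets-complete F))

  allSubsets-unique : ∀ n → Unique (allSubsets n)
  allSubsets-unique zero    = [] ∷ []
  allSubsets-unique (suc n) = Unique.++⁺
    (Unique.map⁺ ∷-injectiveʳ (allSubsets-unique n))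
    (Unique.map⁺ ∷-injectiveʳ (allSubsets-unique n))
    λ (p , q) → disjoint (∈-map⁻ _ p) (∈-map⁻ _ q)
    where
    open import Data.Empty using (⊥)
    disjoint : ∀ {G : Subset (suc n)} →
               (∃ λ F → F ∈ allSubsets n × G ≡ outside ∷ F) →
               (∃ λ F → F ∈ allSubsets n × G ≡ inside ∷ F) → ⊥
    disjoint (_ , _ , refl) (_ , _ , ())

  sublists-All : ∀ {P : A → Set} {xs} → All P xs → All (All P) (sublists xs)
  sublists-All []         = [] ∷ []
  sublists-All (px ∷ pxs) =
    All.++⁺ (All.map⁺ (All.map (px ∷_) (sublists-All pxs))) (sublists-All pxs)

  sublists-Unique : {xs : List A} → Unique xs → All Unique (sublists xs)
  sublists-Unique []       = [] ∷ []
  sublists-Unique (x∉ ∷ u) = All.++⁺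
    (All.map⁺ (All.zipWith (λ (a , b) → a ∷ b) (sublists-All x∉ , sublists-Unique u)))
    (sublists-Unique u)

  filter-∈-sublists : ∀ {P : A → Set} (P? : Decidable P) xs → filter P? xs ∈ sublists xs
  filter-∈-sublists P? []       = here refl
  filter-∈-sublists P? (x ∷ xs) with P? x
  ... | yes _ = ∈-++⁺ˡ (∈-map⁺ _ (filter-∈-sublists P? xs))
  ... | no  _ = ∈-++⁺ʳ _ (filter-∈-sublists P? xs)

  AlmostFisher-resp-↭ : ∀ {k l} {xs ys : List (Subset n)} → xs ↭ ys →
                        AlmostFisher k l xs → AlmostFisher k l ys
  AlmostFisher-resp-↭ p = All-resp-↭ p ∘
    All.map (λ {F} → subst (ℕ._≤ _) (↭-length (filter-↭ (exception? _ F) p)))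

  module _ (𝓕 : Family n) where
    open import Data.List.Membership.DecPropositional {A = Subset n} _≟ˢ_ using (_∈?_)

    canonical : List (Subset n)
    canonical = filter (_∈? members 𝓕) (allSubsets n)

    canonical-↭ : canonical ↭ members 𝓕
    canonical-↭ = ∼bag⇒↭ (unique∧set⇒bag
      (Unique.filter⁺ (_∈? members 𝓕) (allSubsets-unique n)) (distinct 𝓕)
      (mk⇔ (proj₂ ∘ ∈-filter⁻ (_∈? members 𝓕) {xs = allSubsets n})
           (∈-filter⁺ (_∈? members 𝓕) (allSubsets-complete _))))

f-isMaximum : ∀ n k l → IsMaximum (IsFisherSize n k l) (f n k l)
f-isMaximum n k l = attained , bounded
  where
  open import Data.List.Extrema ℕ.≤-totalOrder using (argmax-sel)
  open import Function using (id)
  candidates = filter (almostFisher? k l) (sublists (allSubsets n))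

  attained : IsFisherSize n k l (f n k l)
  attained with argmax-sel id 0 (map length candidates)
  ... | inj₁ eq = family [] [] , [] , sym eq
  ... | inj₂ p with ∈-map⁻ length p
  ...   | xs , xs∈ , eq with ∈-filter⁻ (almostFisher? k l) {xs = sublists (allSubsets n)} xs∈
  ...     | xs∈s , fisher =
    family xs (All.lookup (sublists-Unique (allSubsets-unique n)) xs∈s) , fisher , sym eq

  bounded : ∀ j → IsFisherSize n k l j → j ℕ.≤ f n k l
  bounded _ (𝓕 , fisher , refl) = v≤max⁺ 0 _ (inj₂ (lose
    (∈-map⁺ length (∈-filter⁺ (almostFisher? k l)
      (filter-∈-sublists _ (allSubsets n))
      (AlmostFisher-resp-↭ (↭-sym (canonical-↭ 𝓕)) fisher)))
    (ℕ.≤-reflexive (sym (↭-length (canonical-↭ 𝓕))))))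

-- The real numbers are Cauchy sequences of rationals, compared by _≤ℝ_.
Cauchy : (ℕ → ℚ) → Set
Cauchy x = ∀ ε → 0ℚ ℚ.< ε →
  ∃ λ N → ∀ i j → N ℕ.≤ i → N ℕ.≤ j → ℚ.∣ x i ℚ.- x j ∣ ℚ.≤ ε

record ℝ : Set where
  constructor mkℝ
  field
    seq    : ℕ → ℚ
    cauchy : Cauchy seq

open ℝ public

private
  p≤∣p∣ : ∀ p → p ℚ.≤ ℚ.∣ p ∣
  p≤∣p∣ p with ℚ.∣p∣≡p∨∣p∣≡-p p
  ... | inj₁ eq = ℚ.≤-reflexive (sym eq)
  ... | inj₂ eq = ℚ.≤-trans p≤0 (ℚ.0≤∣p∣ p)
    where
    p≤0 : p ℚ.≤ 0ℚ
    p≤0 = subst (ℚ._≤ 0ℚ)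
      (trans (cong ℚ.-_ eq) (solve 1 (λ p → :- (:- p) := p) refl p))
      (ℚ.neg-antimono-≤ (ℚ.0≤∣p∣ p))

  ∣p-q∣-comm : ∀ p q → ℚ.∣ p ℚ.- q ∣ ≡ ℚ.∣ q ℚ.- p ∣
  ∣p-q∣-comm p q = trans (sym (ℚ.∣-p∣≡∣p∣ (p ℚ.- q)))
    (cong ℚ.∣_∣ (solve 2 (λ p q → :- (p :+ :- q) := q :+ :- p) refl p q))

  close⇒≤ : ∀ p q {ε} → ℚ.∣ p ℚ.- q ∣ ℚ.≤ ε → p ℚ.≤ q ℚ.+ ε
  close⇒≤ p q h = ℚ.≤-trans
    (ℚ.≤-reflexive (solve 2 (λ p q → p := q :+ (p :+ :- q)) refl p q))
    (ℚ.+-monoʳ-≤ q (ℚ.≤-trans (p≤∣p∣ _) h))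

  ≤⇒-≤ : ∀ p q {ε} → p ℚ.≤ q ℚ.+ ε → p ℚ.- q ℚ.≤ ε
  ≤⇒-≤ p q {ε} h = ℚ.≤-trans (ℚ.+-monoˡ-≤ (ℚ.- q) h)
    (ℚ.≤-reflexive (solve 2 (λ q e → (q :+ e) :+ :- q := e) refl q ε))

  ≤⇒close : ∀ p q {ε} → p ℚ.≤ q ℚ.+ ε → q ℚ.≤ p ℚ.+ ε → ℚ.∣ p ℚ.- q ∣ ℚ.≤ ε
  ≤⇒close p q {ε} h k with ℚ.∣p∣≡p∨∣p∣≡-p (p ℚ.- q)
  ... | inj₁ eq = subst (ℚ._≤ ε) (sym eq) (≤⇒-≤ p q h)
  ... | inj₂ eq = subst (ℚ._≤ ε)
    (sym (trans eq (solve 2 (λ p q → :- (p :+ :- q) := q :+ :- p) refl p q))) (≤⇒-≤ q p k)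

  ⊔-≤ : ∀ {a b} c d {ε} → a ℚ.≤ c ℚ.+ ε → b ℚ.≤ d ℚ.+ ε → a ℚ.⊔ b ℚ.≤ (c ℚ.⊔ d) ℚ.+ ε
  ⊔-≤ c d {ε} h k = ℚ.⊔-lub
    (ℚ.≤-trans h (ℚ.+-monoˡ-≤ ε (ℚ.p≤p⊔q c d)))
    (ℚ.≤-trans k (ℚ.+-monoˡ-≤ ε (ℚ.p≤q⊔p c d)))

  ½*-pos : ∀ {ε} → 0ℚ ℚ.< ε → 0ℚ ℚ.< ½ ℚ.* ε
  ½*-pos {ε} h = subst (ℚ._< ½ ℚ.* ε) (ℚ.*-zeroʳ ½) (ℚ.*-monoʳ-<-pos ½ h)

  ½*-double : ∀ ε → ½ ℚ.* ε ℚ.+ ½ ℚ.* ε ≡ ε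
  ½*-double ε = trans (sym (ℚ.*-distribʳ-+ ε ½ ½)) (ℚ.*-identityˡ ε)

  module _ {N M i : ℕ} (h : N ℕ.⊔ M ℕ.≤ i) where
    ⊔≤⇒ˡ : N ℕ.≤ i
    ⊔≤⇒ˡ = ℕ.≤-trans (ℕ.m≤m⊔n N M) h
    ⊔≤⇒ʳ : M ℕ.≤ i
    ⊔≤⇒ʳ = ℕ.≤-trans (ℕ.m≤n⊔m N M) h

fromℚ : ℚ → ℝ
fromℚ q = mkℝ (λ _ → q) λ ε 0<ε → 0 , λ _ _ _ _ →
  subst (λ z → ℚ.∣ z ∣ ℚ.≤ ε) (sym (ℚ.+-inverseʳ q)) (ℚ.<⇒≤ 0<ε)

infixl 6 _+ℝ_ _⊔ℝ_
infix  8 -ℝ_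
infix  4 _≤ℝ_

_+ℝ_ : ℝ → ℝ → ℝ
x +ℝ y = mkℝ (λ i → seq x i ℚ.+ seq y i) prf
  where
  prf : Cauchy (λ i → seq x i ℚ.+ seq y i)
  prf ε 0<ε with cauchy x (½ ℚ.* ε) (½*-pos 0<ε) | cauchy y (½ ℚ.* ε) (½*-pos 0<ε)
  ... | N , hx | M , hy = N ℕ.⊔ M , λ i j pi pj → begin
    ℚ.∣ (seq x i ℚ.+ seq y i) ℚ.- (seq x j ℚ.+ seq y j) ∣
      ≡⟨ cong ℚ.∣_∣ (solve 4 (λ a b c d → (a :+ b) :+ :- (c :+ d)
           := (a :+ :- c) :+ (b :+ :- d)) refl (seq x i) (seq y i) (seq x j) (seq y j)) ⟩
    ℚ.∣ (seq x i ℚ.- seq x j) ℚ.+ (seq y i ℚ.- seq y j) ∣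
      ≤⟨ ℚ.∣p+q∣≤∣p∣+∣q∣ (seq x i ℚ.- seq x j) (seq y i ℚ.- seq y j) ⟩
    ℚ.∣ seq x i ℚ.- seq x j ∣ ℚ.+ ℚ.∣ seq y i ℚ.- seq y j ∣
      ≤⟨ ℚ.+-mono-≤ (hx i j (⊔≤⇒ˡ pi) (⊔≤⇒ˡ pj)) (hy i j (⊔≤⇒ʳ {N} pi) (⊔≤⇒ʳ {N} pj)) ⟩
    ½ ℚ.* ε ℚ.+ ½ ℚ.* ε
      ≡⟨ ½*-double ε ⟩
    ε ∎
    where open ℚ.≤-Reasoning

-ℝ_ : ℝ → ℝ
-ℝ x = mkℝ (λ i → ℚ.- seq x i) λ ε 0<ε → let N , h = cauchy x ε 0<ε in
  N , λ i j pi pj → subst (ℚ._≤ ε)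
    (trans (∣p-q∣-comm (seq x i) (seq x j)) (cong ℚ.∣_∣
      (solve 2 (λ a b → b :+ :- a := (:- a) :+ :- (:- b)) refl (seq x i) (seq x j))))
    (h i j pi pj)

_⊔ℝ_ : ℝ → ℝ → ℝ
x ⊔ℝ y = mkℝ (λ i → seq x i ℚ.⊔ seq y i) prf
  where
  prf : Cauchy (λ i → seq x i ℚ.⊔ seq y i)
  prf ε 0<ε with cauchy x ε 0<ε | cauchy y ε 0<ε
  ... | N , hx | M , hy = N ℕ.⊔ M , λ i j pi pj → ≤⇒close _ _ (half i j pi pj) (half j i pj pi)
    where
    half : ∀ i j → N ℕ.⊔ M ℕ.≤ i → N ℕ.⊔ M ℕ.≤ j →
           seq x i ℚ.⊔ seq y i ℚ.≤ (seq x j ℚ.⊔ seq y j) ℚ.+ ε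
    half i j pi pj = ⊔-≤ (seq x j) (seq y j)
      (close⇒≤ (seq x i) (seq x j) (hx i j (⊔≤⇒ˡ pi) (⊔≤⇒ˡ pj)))
      (close⇒≤ (seq y i) (seq y j) (hy i j (⊔≤⇒ʳ {N} pi) (⊔≤⇒ʳ {N} pj)))

∣_∣ℝ : ℝ → ℝ
∣ x ∣ℝ = x ⊔ℝ (-ℝ x)

-- The slack ε makes the order independent of the chosen representatives.
_≤ℝ_ : ℝ → ℝ → Set
x ≤ℝ y = ∀ ε → 0ℚ ℚ.< ε → ∃ λ N → ∀ i → N ℕ.≤ i → seq x i ℚ.≤ seq y i ℚ.+ ε

fromℕ : ℕ → ℚ
fromℕ m = + m ℚ./ 1

_isLittleOOfArgument : (ℕ → ℝ) → Set
g isLittleOOfArgument = ∀ ε → 0ℚ ℚ.< ε →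
  ∃ λ N → ∀ l → N ℕ.≤ l → ∣ g l ∣ℝ ≤ℝ fromℚ (ε ℚ.* fromℕ l)

{-# OPTIONS --safe #-}
module Submission where

-- A 1-almost l-Fisher family of L sets on n points splits into pairs, each consisting of two
-- sets whose intersection has the wrong size, and singletons.  In terms of characteristic
-- vectors, the Gram matrix is l times the all-ones matrix plus a block diagonal matrix D
-- with one block for each pair or singleton.
--
-- If every block but at most one is positive definite, then discarding that block leaves
-- linearly independent vectors, so L is at most n + 2 (one-bad-block).
--
-- Otherwise take two blocks that are not positive definite.  In each, a weighted average of
-- the members has squared length at most l, and the two averages have inner product l; so
-- they are equal.  For a pair, the average is 1 on the points of both members, 0 on those of
-- neither, and strictly between on the others; hence the sum W of the two members (twice the
-- member, for a singleton) is the same vector for both blocks (TwoBadBlocks.blockSum-≗).  Let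
-- N be the number of points where W is 1; it is positive, as the blocks differ.  Each member X has inner product 2 l with W, and W has squared length 4 l, so the
-- vectors V = 2 X - W are orthogonal except within pairs.  Each V is 1 or -1 on the N points,
-- and elsewhere 0 or a value that is 2 or -2 depending only on the point.
--
-- Orthogonality up to pairs shows that any signed sum of the vectors V has squared length at
-- most 2 H, where H is the sum of their squared lengths (Balanced.signed-sum).  Choosing the
-- signs to agree at one of the N points gives that L squared is at most 2 H.  Choosing all
-- signs positive bounds the contribution of the remaining points to H, and gives that H is
-- at most L (N + O(sqrt N)) when n is at most L (Balanced.energy-bound).  Together they say
-- that L is at most 2 N + O(sqrt N) (Balanced.size-bound).  Finally N is at most 4 l and 3 N is at most 4 (n - l), both by counting pointwise in the squared
-- length of W, so 2 N is at most 8 min(l, (n - l) / 3), and the error is O(sqrt l).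

open import Defs
open import Data.Nat as ℕ using (ℕ)
open import Data.Integer as ℤ using (+_)
open import Data.Rational as ℚ using (_/_)
open import Data.Product using (∃; _×_)

import Data.Integer.Properties as ℤₚ
open import Algebra.Properties.Semiring.Sum ℤₚ.+-*-semiring
open import Data.Bool.Base using (Bool; true; false)
open import Data.Empty using (⊥-elim)
open import Data.Fin.Base using (Fin; zero; suc; punchIn; fromℕ<)
open import Data.Fin.Permutation using (permutation)
open import Data.Fin.Properties using (any?) renaming (_≟_ to _≟ᶠ_)
open import Data.Fin.Subset using (Subset; _∩_; ∣_∣)
open import Data.Fin.Subset.Properties using (∩-comm)
open import Data.Integer.Base
  using (ℤ; -[1+_]; 0ℤ; 1ℤ; -1ℤ; _+_; _*_; -_; _-_; _≤_; _<_; +≤+; +<+)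
open import Data.Integer.Properties
  using ( pos-*; +-mono-≤; +-identityˡ; +-identityʳ; *-comm; *-zeroˡ; *-zeroʳ
        ; *-identityˡ; i*j≡0⇒i≡0∨j≡0; ≤-antisym; ≤-refl; ≤-trans; ≤-reflexive; <⇒≤; ≰⇒>
        ; i≤j⇒0≤j-i; 0≤i-j⇒j≤i; *-cancelˡ-≤-pos; _≤?_ )
open import Data.Integer.Solver using (module +-*-Solver)
open import Data.List.Base using (List; []; _∷_; length; filter; lookup)
open import Data.List.Membership.Propositional using (lose)
open import Data.List.Membership.Propositional.Properties using (∈-lookup)
open import Data.List.Properties using (filter-some)
open import Data.List.Relation.Unary.All as All using (All)
open import Data.List.Relation.Unary.AllPairs using ([]; _∷_)
open import Data.List.Relation.Unary.Unique.Propositional using (Unique)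
open import Data.Nat.Base using (zero; suc)
import Data.Nat.Properties as ℕₚ
import Data.Nat.Solver
open import Data.Product using (_,_; proj₁; proj₂; Σ-syntax; ∃-syntax)
import Data.Rational.Properties as ℚₚ
import Data.Rational.Unnormalised.Base as ℚᵘ
open import Data.Rational.Unnormalised.Base using (mkℚᵘ)
import Data.Rational.Unnormalised.Properties as ℚᵘₚ
open import Data.Sum using (_⊎_; inj₁; inj₂; [_,_]′)
open import Data.Vec.Base as Vec using ([]; _∷_)
open import Data.Vec.Functional using (insertAt; removeAt)
open import Data.Vec.Functional.Properties using (insertAt-lookup; insertAt-punchIn)
open import Function using (_∘_)
open import Relation.Binary.PropositionalEquality
  using (_≡_; _≢_; _≗_; refl; sym; trans; cong; cong₂; subst; subst₂; module ≡-Reasoning)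
open import Relation.Nullary using (¬_; Dec; yes; no; ¬?; _×-dec_)
open import Relation.Nullary.Decidable using (decidable-stable)
open import Relation.Unary using (Decidable)

open +-*-Solver using (solve; _:=_; _:+_; _:*_; _:-_; :-_; con)
module ℕ-solver = Data.Nat.Solver.+-*-Solver
open ℕ-solver using () renaming (_:=_ to _⊜_; _:+_ to _⊕_; _:*_ to _⊗_; con to con′)

-- Inequalities between integers

0≤+ : ∀ {a b} → 0ℤ ≤ a → 0ℤ ≤ b → 0ℤ ≤ a + b
0≤+ = +-mono-≤

0≤* : ∀ {a b} → 0ℤ ≤ a → 0ℤ ≤ b → 0ℤ ≤ a * b
0≤* {+ m} {+ n} (+≤+ _) (+≤+ _) = subst (0ℤ ≤_) (pos-* m n) (+≤+ ℕ.z≤n)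

0≤sq : ∀ a → 0ℤ ≤ a * a
0≤sq (+ m)    = 0≤* {+ m} {+ m} (+≤+ ℕ.z≤n) (+≤+ ℕ.z≤n)
0≤sq -[1+ m ] = +≤+ ℕ.z≤n

sq≤0⇒≡0 : ∀ a → a * a ≤ 0ℤ → a ≡ 0ℤ
sq≤0⇒≡0 a h with i*j≡0⇒i≡0∨j≡0 a (≤-antisym h (0≤sq a))
... | inj₁ p = p
... | inj₂ p = p

-- To prove an inequality, exhibit the difference as a manifestly nonnegative expression.
by-difference : ∀ {a b d} → b - a ≡ d → 0ℤ ≤ d → a ≤ b
by-difference eq h = 0≤i-j⇒j≤i (subst (0ℤ ≤_) (sym eq) h)

cancel-positive : ∀ {k a b} → 0ℤ < k → k * a ≤ k * b → a ≤ b
cancel-positive {+ suc m} {a} {b} _ = *-cancelˡ-≤-pos a b (+ suc m)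
cancel-positive {+ zero} (+<+ ())

*-pos≡0 : ∀ {k a} → 0ℤ < k → k * a ≡ 0ℤ → a ≡ 0ℤ
*-pos≡0 {k} 0<k h with i*j≡0⇒i≡0∨j≡0 k h
... | inj₁ refl = ⊥-elim (ℤₚ.<-irrefl refl 0<k)
... | inj₂ p    = p

0≤+≡0ˡ : ∀ {a b} → 0ℤ ≤ a → 0ℤ ≤ b → a + b ≡ 0ℤ → a ≡ 0ℤ
0≤+≡0ˡ {a} {b} 0≤a 0≤b h = ≤-antisym
  (by-difference (trans (solve 2 (λ a b → con 0ℤ :- a := b :- (a :+ b)) refl a b)
                        (trans (cong (λ x → b - x) h) (+-identityʳ b))) 0≤b) 0≤a

≢0⇒0< : ∀ {a} → 0ℤ ≤ a → a ≢ 0ℤ → 0ℤ < a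
≢0⇒0< 0≤a a≢0 = ≰⇒> λ a≤0 → a≢0 (≤-antisym a≤0 0≤a)

-- Finite sums of integers

∑-0≤ : ∀ {n} (t : Fin n → ℤ) → (∀ i → 0ℤ ≤ t i) → 0ℤ ≤ ∑[ i < n ] t i
∑-0≤ {zero}  t h = ≤-refl
∑-0≤ {suc n} t h = 0≤+ (h zero) (∑-0≤ (t ∘ suc) (h ∘ suc))

∑-mono : ∀ {n} {s t : Fin n → ℤ} → (∀ i → s i ≤ t i) → ∑[ i < n ] s i ≤ ∑[ i < n ] t i
∑-mono {zero}  h = ≤-refl
∑-mono {suc n} h = +-mono-≤ (h zero) (∑-mono (h ∘ suc))

term≤∑ : ∀ {n} (t : Fin n → ℤ) → (∀ i → 0ℤ ≤ t i) → ∀ i → t i ≤ ∑[ j < n ] t j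
term≤∑ {suc n} t h zero =
  subst (_≤ t zero + sum (t ∘ suc)) (+-identityʳ (t zero))
    (+-mono-≤ (≤-refl {t zero}) (∑-0≤ (t ∘ suc) (h ∘ suc)))
term≤∑ {suc n} t h (suc i) =
  subst (_≤ t zero + sum (t ∘ suc)) (+-identityˡ (t (suc i)))
    (+-mono-≤ (h zero) (term≤∑ (t ∘ suc) (h ∘ suc) i))

∑-zero : ∀ {n} (t : Fin n → ℤ) → (∀ i → t i ≡ 0ℤ) → ∑[ i < n ] t i ≡ 0ℤ
∑-zero {n} t h = trans (sum-cong-≗ h) (sum-replicate-zero n)

∑-const : ∀ n a → ∑[ i < n ] a ≡ + n * a
∑-const zero    a = sym (*-zeroˡ a)
∑-const (suc n) a = trans (cong (_+_ a) (∑-const n a))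
  (solve 2 (λ a m → a :+ m :* a := (con 1ℤ :+ m) :* a) refl a (+ n))

∑-linear : ∀ {n} a b (s t : Fin n → ℤ) →
           ∑[ i < n ] (a * s i + b * t i) ≡ a * ∑[ i < n ] s i + b * ∑[ i < n ] t i
∑-linear a b s t = trans (∑-distrib-+ (λ i → a * s i) (λ i → b * t i))
  (sym (cong₂ _+_ (*-distribˡ-sum a s) (*-distribˡ-sum b t)))

∑-single : ∀ {n} (t : Fin n → ℤ) i → (∀ j → j ≢ i → t j ≡ 0ℤ) → ∑[ j < n ] t j ≡ t i
∑-single t zero    h = trans (cong (_+_ (t zero)) (∑-zero (t ∘ suc) λ j → h (suc j) λ ()))
  (+-identityʳ _)
∑-single t (suc i) h = trans (cong₂ _+_ (h zero λ ())
    (∑-single (t ∘ suc) i λ j j≢i → h (suc j) λ { refl → j≢i refl }))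
  (+-identityˡ _)

∑-pair : ∀ {n} (t : Fin n → ℤ) i k → i ≢ k → (∀ j → j ≢ i → j ≢ k → t j ≡ 0ℤ) →
         ∑[ j < n ] t j ≡ t i + t k
∑-pair t zero zero i≢k h = ⊥-elim (i≢k refl)
∑-pair t zero (suc k) i≢k h = cong (_+_ (t zero))
  (∑-single (t ∘ suc) k λ j j≢k → h (suc j) (λ ()) λ { refl → j≢k refl })
∑-pair t (suc i) zero i≢k h = trans (ℤₚ.+-comm (t zero) _) (cong (_+ t zero)
  (∑-single (t ∘ suc) i λ j j≢i → h (suc j) (λ { refl → j≢i refl }) λ ()))
∑-pair t (suc i) (suc k) i≢k h = trans
  (cong₂ _+_ (h zero (λ ()) λ ())
    (∑-pair (t ∘ suc) i k (λ { refl → i≢k refl })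
      λ j j≢i j≢k → h (suc j) (λ { refl → j≢i refl }) λ { refl → j≢k refl }))
  (+-identityˡ _)

-- The inner product on integer vectors

⟨_,_⟩ : ∀ {n} → (Fin n → ℤ) → (Fin n → ℤ) → ℤ
⟨_,_⟩ {n} u v = ∑[ p < n ] (u p * v p)

⟨⟩-comm : ∀ {n} (u v : Fin n → ℤ) → ⟨ u , v ⟩ ≡ ⟨ v , u ⟩
⟨⟩-comm u v = sum-cong-≗ λ p → *-comm (u p) (v p)

0≤⟨v,v⟩ : ∀ {n} (v : Fin n → ℤ) → 0ℤ ≤ ⟨ v , v ⟩
0≤⟨v,v⟩ v = ∑-0≤ _ (0≤sq ∘ v)

⟨v,v⟩≤0⇒v≗0 : ∀ {n} (v : Fin n → ℤ) → ⟨ v , v ⟩ ≤ 0ℤ → ∀ p → v p ≡ 0ℤ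
⟨v,v⟩≤0⇒v≗0 v h p = sq≤0⇒≡0 (v p) (≤-trans (term≤∑ _ (0≤sq ∘ v) p) h)

⟨⟩-linear : ∀ {n} a b (u v w : Fin n → ℤ) →
            ⟨ (λ p → a * u p + b * v p) , w ⟩ ≡ a * ⟨ u , w ⟩ + b * ⟨ v , w ⟩
⟨⟩-linear a b u v w = trans
  (sum-cong-≗ λ p → solve 5 (λ a b u v w →
    (a :* u :+ b :* v) :* w := a :* (u :* w) :+ b :* (v :* w)) refl a b (u p) (v p) (w p))
  (∑-linear a b (λ p → u p * w p) (λ p → v p * w p))

⟨⟩-linear-sq : ∀ {n} a b (u v : Fin n → ℤ) → let w = λ p → a * u p + b * v p in
  ⟨ w , w ⟩ ≡ a * a * ⟨ u , u ⟩ + + 2 * (a * b) * ⟨ u , v ⟩ + b * b * ⟨ v , v ⟩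
⟨⟩-linear-sq a b u v = begin
  ⟨ w , w ⟩                                                       ≡⟨ ⟨⟩-linear a b u v w ⟩
  a * ⟨ u , w ⟩ + b * ⟨ v , w ⟩                                   ≡⟨ cong₂ (λ x y → a * x + b * y) (⟨⟩-comm u w) (⟨⟩-comm v w) ⟩
  a * ⟨ w , u ⟩ + b * ⟨ w , v ⟩                                   ≡⟨ cong₂ (λ x y → a * x + b * y) (⟨⟩-linear a b u v u) (⟨⟩-linear a b u v v) ⟩
  a * (a * ⟨ u , u ⟩ + b * ⟨ v , u ⟩) + b * (a * ⟨ u , v ⟩ + b * ⟨ v , v ⟩)
    ≡⟨ cong (λ x → a * (a * ⟨ u , u ⟩ + b * x) + b * (a * ⟨ u , v ⟩ + b * ⟨ v , v ⟩)) (⟨⟩-comm v u) ⟩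
  a * (a * ⟨ u , u ⟩ + b * ⟨ u , v ⟩) + b * (a * ⟨ u , v ⟩ + b * ⟨ v , v ⟩)
    ≡⟨ solve 5 (λ a b uu uv vv → a :* (a :* uu :+ b :* uv) :+ b :* (a :* uv :+ b :* vv)
         := a :* a :* uu :+ con (+ 2) :* (a :* b) :* uv :+ b :* b :* vv) refl a b ⟨ u , u ⟩ ⟨ u , v ⟩ ⟨ v , v ⟩ ⟩
  a * a * ⟨ u , u ⟩ + + 2 * (a * b) * ⟨ u , v ⟩ + b * b * ⟨ v , v ⟩ ∎
  where
  open ≡-Reasoning
  w = λ p → a * u p + b * v p

-- The linear combination of the vectors v i with coefficients c i.
combination : ∀ {n L} → (Fin L → ℤ) → (Fin L → Fin n → ℤ) → Fin n → ℤ
combination {L = L} c v p = ∑[ i < L ] (c i * v i p)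

⟨combination⟩ : ∀ {n L} (c : Fin L → ℤ) (v : Fin L → Fin n → ℤ) w →
                ⟨ combination c v , w ⟩ ≡ ∑[ i < L ] (c i * ⟨ v i , w ⟩)
⟨combination⟩ {n} {L} c v w = begin
  ∑[ p < n ] (combination c v p * w p)           ≡⟨ sum-cong-≗ (λ p → *-distribʳ-sum (w p) (λ i → c i * v i p)) ⟩
  ∑[ p < n ] ∑[ i < L ] (c i * v i p * w p)      ≡⟨ ∑-comm (λ p i → c i * v i p * w p) ⟩
  ∑[ i < L ] ∑[ p < n ] (c i * v i p * w p)      ≡⟨ sum-cong-≗ (λ i → trans
      (sum-cong-≗ λ p → ℤₚ.*-assoc (c i) (v i p) (w p))
      (sym (*-distribˡ-sum (c i) (λ p → v i p * w p)))) ⟩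
  ∑[ i < L ] (c i * ⟨ v i , w ⟩) ∎
  where open ≡-Reasoning

-- Linear dependence

-- Some nontrivial integer combination of the vectors vanishes.
Dependent : ∀ {n L} → (Fin L → Fin n → ℤ) → Set
Dependent {L = L} v = Σ[ c ∈ (Fin L → ℤ) ] (∃[ i ] c i ≢ 0ℤ) × (∀ p → combination c v p ≡ 0ℤ)

-- More vectors than coordinates are dependent, by Gaussian elimination without division: a
-- vector with nonzero first coordinate serves to clear that coordinate in all others.
dependent : ∀ {n L} → n ℕ.< L → (v : Fin L → Fin n → ℤ) → Dependent v
dependent {zero}  {suc L} _ v = (λ _ → 1ℤ) , (zero , λ ()) , λ ()
dependent {suc n} {suc L} n<L v with any? (λ i → ¬? (v i zero ℤₚ.≟ 0ℤ))
... | no all-zero =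
  let c , nonzero , vanishes = dependent (ℕₚ.<-trans (ℕₚ.n<1+n n) n<L) (λ i → v i ∘ suc) in
  c , nonzero , λ where
    zero    → ∑-zero _ λ i → trans
      (cong (c i *_) (decidable-stable (v i zero ℤₚ.≟ 0ℤ) λ ≢0 → all-zero (i , ≢0)))
      (*-zeroʳ (c i))
    (suc p) → vanishes p
... | yes (i , pivot≢0) =
  c , (punchIn i k , c[k]≢0) , λ p → trans (combination-c p) (eliminated p)
  where
  pivot = v i zero
  others : Fin L → Fin (suc n) → ℤ
  others = removeAt v i
  reduced : Fin L → Fin (suc n) → ℤ
  reduced k p = pivot * others k p - others k zero * v i p
  ih = dependent (ℕ.s≤s⁻¹ n<L) (λ k → reduced k ∘ suc)
  c′ = proj₁ ih
  k  = proj₁ (proj₁ (proj₂ ih))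
  x  = - (∑[ k < L ] (c′ k * others k zero))
  c  = insertAt (λ k → pivot * c′ k) i x

  c[k]≢0 : c (punchIn i k) ≢ 0ℤ
  c[k]≢0 h with i*j≡0⇒i≡0∨j≡0 pivot
                  (trans (sym (insertAt-punchIn (λ k → pivot * c′ k) i x k)) h)
  ... | inj₁ p = pivot≢0 p
  ... | inj₂ p = proj₂ (proj₁ (proj₂ ih)) p

  combination-c : ∀ p → combination c v p ≡ combination c′ reduced p
  combination-c p = begin
    combination c v p
      ≡⟨ sum-remove {i = i} (λ j → c j * v j p) ⟩
    c i * v i p + ∑[ k < L ] (c (punchIn i k) * others k p)
      ≡⟨ cong₂ (λ y z → y * v i p + z) (insertAt-lookup (λ k → pivot * c′ k) i x)
           (sum-cong-≗ λ k → cong (_* others k p) (insertAt-punchIn (λ k → pivot * c′ k) i x k)) ⟩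
    x * v i p + ∑[ k < L ] (pivot * c′ k * others k p)
      ≡⟨ cong₂ _+_
           (solve 2 (λ s y → (:- s) :* y := (:- y) :* s) refl (∑[ k < L ] (c′ k * others k zero)) (v i p))
           (trans (sum-cong-≗ λ k → ℤₚ.*-assoc pivot (c′ k) (others k p))
                  (sym (*-distribˡ-sum pivot (λ k → c′ k * others k p)))) ⟩
    - v i p * ∑[ k < L ] (c′ k * others k zero) + pivot * ∑[ k < L ] (c′ k * others k p)
      ≡⟨ sym (∑-linear (- v i p) pivot (λ k → c′ k * others k zero) (λ k → c′ k * others k p)) ⟩
    ∑[ k < L ] (- v i p * (c′ k * others k zero) + pivot * (c′ k * others k p))
      ≡⟨ sum-cong-≗ (λ k → solve 5 (λ y a c o z → (:- y) :* (c :* z) :+ a :* (c :* o)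
           := c :* (a :* o :- z :* y)) refl (v i p) pivot (c′ k) (others k p) (others k zero)) ⟩
    combination c′ reduced p ∎
    where open ≡-Reasoning

  eliminated : ∀ p → combination c′ reduced p ≡ 0ℤ
  eliminated zero    = ∑-zero _ λ k →
    solve 3 (λ c a z → c :* (a :* z :- z :* a) := con 0ℤ) refl (c′ k) pivot (others k zero)
  eliminated (suc p) = proj₂ (proj₂ ih) p

-- Families in which each member has at most one exceptional partner

Bit : ℤ → Set
Bit x = x ≡ 0ℤ ⊎ x ≡ 1ℤ

-- Level q y w: the fraction y / q is 0, strictly between 0 and 1, or 1, according as w is
-- 0, 1 or 2.
data Level (q : ℤ) : ℤ → ℤ → Set where
  bottom : Level q 0ℤ 0ℤ
  middle : ∀ {y} → 0ℤ < y → y < q → Level q y 1ℤ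
  top    : Level q q (+ 2)

level-determined : ∀ {q r y z s t} → 0ℤ < q → 0ℤ < r → Level q y s → Level r z t →
                   r * y ≡ q * z → s ≡ t
level-determined {q} {r} 0<q 0<r = λ where
    bottom bottom eq → refl
    bottom (middle 0<z _) eq → ⊥-elim (0≢ 0<q 0<z (trans (sym eq) (*-zeroʳ r)))
    bottom top eq → ⊥-elim (0≢ 0<q 0<r (trans (sym eq) (*-zeroʳ r)))
    (middle 0<y _) bottom eq → ⊥-elim (0≢ 0<r 0<y (trans eq (*-zeroʳ q)))
    (middle _ _) (middle _ _) eq → refl
    (middle _ y<q) top eq → ⊥-elim (<≢ 0<r y<q (trans eq (*-comm q r)))
    top bottom eq → ⊥-elim (0≢ 0<r 0<q (trans eq (*-zeroʳ q)))
    top (middle _ z<r) eq → ⊥-elim (<≢ 0<q z<r (trans (sym eq) (*-comm r q)))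
    top top eq → refl
  where
  0≢ : ∀ {k x} → 0ℤ < k → 0ℤ < x → k * x ≢ 0ℤ
  0≢ 0<k 0<x h = ℤₚ.<-irrefl (sym (*-pos≡0 0<k h)) 0<x
  <≢ : ∀ {k x y} → 0ℤ < k → x < y → k * x ≢ k * y
  <≢ 0<k x<y h = ℤₚ.<⇒≱ x<y (cancel-positive 0<k (≤-reflexive (sym h)))

single-level : ∀ {x z} → Bit x → z ≡ x → Level 1ℤ (1ℤ * x + 0ℤ * z) (x + z)
single-level (inj₁ refl) refl = bottom
single-level (inj₂ refl) refl = top

pair-level : ∀ {u v x z} → 0ℤ < u → 0ℤ < v → Bit x → Bit z → Level (u + v) (u * x + v * z) (x + z)
pair-level {u} {v} 0<u 0<v = λ where
    (inj₁ refl) (inj₁ refl) → at (solve 2 (λ u v → con 0ℤ := u :* con 0ℤ :+ v :* con 0ℤ) refl u v) bottom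
    (inj₁ refl) (inj₂ refl) → at (solve 2 (λ u v → v := u :* con 0ℤ :+ v :* con 1ℤ) refl u v)
      (middle 0<v (subst (_< u + v) (+-identityˡ v) (ℤₚ.+-monoˡ-< v 0<u)))
    (inj₂ refl) (inj₁ refl) → at (solve 2 (λ u v → u := u :* con 1ℤ :+ v :* con 0ℤ) refl u v)
      (middle 0<u (subst (_< u + v) (+-identityʳ u) (ℤₚ.+-monoʳ-< u 0<v)))
    (inj₂ refl) (inj₂ refl) → at (solve 2 (λ u v → u :+ v := u :* con 1ℤ :+ v :* con 1ℤ) refl u v) top
  where
  at : ∀ {y z w} → y ≡ z → Level (u + v) y w → Level (u + v) z w
  at refl lv = lv

-- The characteristic vectors X i of L distinct sets.  The involution π sends a set to the
-- unique other set that it meets in a number of points different from l, and fixes it if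
-- there is none.
record Paired (n L : ℕ) (l : ℤ) : Set where
  field
    X         : Fin L → Fin n → ℤ
    bit       : ∀ i p → Bit (X i p)
    injective : ∀ i j → X i ≗ X j → i ≡ j
    π         : Fin L → Fin L
    π-invol   : ∀ i → π (π i) ≡ i
    meet      : ∀ i j → j ≢ i → j ≢ π i → ⟨ X i , X j ⟩ ≡ l
    exception : ∀ i → π i ≢ i → ⟨ X i , X (π i) ⟩ ≢ l
    0≤l       : 0ℤ ≤ l

module _ {n L : ℕ} {l : ℤ} (𝒫 : Paired n L l) where
  open Paired 𝒫

  -- The Gram matrix of X is l times the all-ones matrix plus a block diagonal matrix with
  -- one block for each orbit of π; det i is the determinant of the block of i.
  det : Fin L → ℤ
  det i with π i ≟ᶠ i
  ... | yes _ = ⟨ X i , X i ⟩ - l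
  ... | no  _ = (⟨ X i , X i ⟩ - l) * (⟨ X (π i) , X (π i) ⟩ - l)
                - (⟨ X i , X (π i) ⟩ - l) * (⟨ X i , X (π i) ⟩ - l)

  -- The block of i, multiplied by the vector of weights of its one or two members, is det i
  -- times the all-ones vector.  For a pair, weight i is the number of points of the
  -- partner of i outside i.
  weight : Fin L → ℤ
  weight i with π i ≟ᶠ i
  ... | yes _ = 1ℤ
  ... | no  _ = ⟨ X (π i) , X (π i) ⟩ - ⟨ X i , X (π i) ⟩

  -- The block of i is not positive definite.
  Bad : Fin L → Set
  Bad i = det i ≤ 0ℤ

  meet≤size : ∀ i j → ⟨ X i , X j ⟩ ≤ ⟨ X j , X j ⟩
  meet≤size i j = ∑-mono λ p → bits (bit i p) (bit j p)
    where
    bits : ∀ {x y} → Bit x → Bit y → x * y ≤ y * y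
    bits (inj₁ refl) (inj₁ refl) = +≤+ ℕ.z≤n
    bits (inj₁ refl) (inj₂ refl) = +≤+ ℕ.z≤n
    bits (inj₂ refl) (inj₁ refl) = +≤+ ℕ.z≤n
    bits (inj₂ refl) (inj₂ refl) = ≤-refl

  0≤weight : ∀ i → 0ℤ ≤ weight i
  0≤weight i with π i ≟ᶠ i
  ... | yes _ = +≤+ ℕ.z≤n
  ... | no  _ = i≤j⇒0≤j-i (meet≤size i (π i))

  -- A linear relation among the X i expresses each coefficient through the sum of all.
  module Relation (c : Fin L → ℤ) (vanishes : ∀ p → combination c X p ≡ 0ℤ) where

    total : ℤ
    total = ∑[ j < L ] c j

    row : ∀ i → ∑[ j < L ] (c j * (⟨ X i , X j ⟩ - l)) ≡ - l * total
    row i = begin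
      ∑[ j < L ] (c j * (⟨ X i , X j ⟩ - l))
        ≡⟨ sum-cong-≗ (λ j → trans (cong (λ x → c j * (x - l)) (⟨⟩-comm (X i) (X j)))
             (solve 3 (λ c g l → c :* (g :- l) := con 1ℤ :* (c :* g) :+ (:- l) :* c)
               refl (c j) ⟨ X j , X i ⟩ l)) ⟩
      ∑[ j < L ] (1ℤ * (c j * ⟨ X j , X i ⟩) + - l * c j)
        ≡⟨ ∑-linear 1ℤ (- l) (λ j → c j * ⟨ X j , X i ⟩) c ⟩
      1ℤ * ∑[ j < L ] (c j * ⟨ X j , X i ⟩) + - l * total
        ≡⟨ cong (λ x → 1ℤ * x + - l * total) (trans (sym (⟨combination⟩ c X (X i)))
             (∑-zero _ λ p → trans (cong (_* X i p) (vanishes p)) (*-zeroˡ (X i p)))) ⟩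
      1ℤ * 0ℤ + - l * total
        ≡⟨ +-identityˡ _ ⟩
      - l * total ∎
      where open ≡-Reasoning

    off-block : ∀ i j → j ≢ i → j ≢ π i → c j * (⟨ X i , X j ⟩ - l) ≡ 0ℤ
    off-block i j j≢i j≢πi = trans
      (cong (λ x → c j * (x - l)) (meet i j j≢i j≢πi))
      (solve 2 (λ c l → c :* (l :- l) := con 0ℤ) refl (c j) l)

    det*c : ∀ i → det i * c i ≡ - l * total * weight i
    det*c i with π i ≟ᶠ i
    ... | yes πi≡i = begin
      (⟨ X i , X i ⟩ - l) * c i               ≡⟨ *-comm _ (c i) ⟩
      c i * (⟨ X i , X i ⟩ - l)               ≡⟨ sym (∑-single _ i λ j j≢i →
                                                  off-block i j j≢i λ j≡πi → j≢i (trans j≡πi πi≡i)) ⟩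
      ∑[ j < L ] (c j * (⟨ X i , X j ⟩ - l))  ≡⟨ row i ⟩
      - l * total                             ≡⟨ sym (ℤₚ.*-identityʳ _) ⟩
      - l * total * 1ℤ ∎
      where open ≡-Reasoning
    ... | no πi≢i = begin
      ((a - l) * (b - l) - (g - l) * (g - l)) * c i
        ≡⟨ solve 6 (λ a b g l x y → ((a :- l) :* (b :- l) :- (g :- l) :* (g :- l)) :* x
             := (b :- l) :* (x :* (a :- l) :+ y :* (g :- l))
                :- (g :- l) :* (y :* (b :- l) :+ x :* (g :- l))) refl a b g l (c i) (c (π i)) ⟩
      (b - l) * (c i * (a - l) + c (π i) * (g - l))
        - (g - l) * (c (π i) * (b - l) + c i * (g - l))
        ≡⟨ cong₂ (λ x y → (b - l) * x - (g - l) * y) row-i row-πi ⟩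
      (b - l) * (- l * total) - (g - l) * (- l * total)
        ≡⟨ solve 4 (λ b g l s → (b :- l) :* ((:- l) :* s) :- (g :- l) :* ((:- l) :* s)
             := (:- l) :* s :* (b :- g)) refl b g l total ⟩
      - l * total * (b - g) ∎
      where
      open ≡-Reasoning
      a = ⟨ X i , X i ⟩
      b = ⟨ X (π i) , X (π i) ⟩
      g = ⟨ X i , X (π i) ⟩
      row-i : c i * (a - l) + c (π i) * (g - l) ≡ - l * total
      row-i = trans (sym (∑-pair _ i (π i) (πi≢i ∘ sym) (off-block i))) (row i)
      row-πi : c (π i) * (b - l) + c i * (g - l) ≡ - l * total
      row-πi = trans (cong (λ x → c (π i) * (b - l) + c i * (x - l)) (⟨⟩-comm (X i) (X (π i))))
        (trans (sym (∑-pair _ (π i) i πi≢i λ j j≢πi j≢i →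
                  off-block (π i) j j≢πi λ j≡ππi → j≢i (trans j≡ππi (π-invol i))))
               (row (π i)))

    -- Coefficients of positive blocks never have the sign of the total; hence, if the
    -- others vanish, so does the total, and with it every coefficient.
    trivial : (∀ i → Bad i → c i ≡ 0ℤ) → ∀ i → c i ≡ 0ℤ
    trivial bad≡0 i with det i ≤? 0ℤ
    ... | yes bad = bad≡0 i bad
    ... | no good = *-pos≡0 (≰⇒> good) (trans (det*c i)
      (trans (cong (λ x → - l * x * weight i) total≡0)
        (solve 2 (λ l e → (:- l) :* con 0ℤ :* e := con 0ℤ) refl l (weight i))))
      where
      opposite : ∀ j → c j * total ≤ 0ℤ
      opposite j with det j ≤? 0ℤ
      ... | yes bad = ≤-reflexive (trans (cong (_* total) (bad≡0 j bad)) (*-zeroˡ total))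
      ... | no good = cancel-positive (≰⇒> good) (by-difference
        (trans (solve 3 (λ d c s → d :* con 0ℤ :- d :* (c :* s) := :- (d :* c) :* s) refl (det j) (c j) total)
          (trans (cong (λ x → - x * total) (det*c j))
            (solve 3 (λ l s e → (:- ((:- l) :* s :* e)) :* s := l :* e :* (s :* s)) refl l total (weight j))))
        (0≤* (0≤* 0≤l (0≤weight j)) (0≤sq total)))
      total≡0 : total ≡ 0ℤ
      total≡0 = sq≤0⇒≡0 total (≤-trans (≤-reflexive (*-distribʳ-sum total c))
        (≤-trans (∑-mono opposite) (≤-reflexive (∑-zero {L} _ λ _ → refl))))

  -- If only one block can fail to be positive definite, two further coordinates that
  -- force the coefficients of its members to vanish make the vectors X i independent.
  one-bad-block : ∀ i₀ → (∀ i → Bad i → i ≡ i₀ ⊎ i ≡ π i₀) → L ℕ.≤ suc (suc n)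
  one-bad-block i₀ only = ℕₚ.≮⇒≥ λ n+2<L →
    let c , (k , c[k]≢0) , vanishes = dependent n+2<L extended in
    c[k]≢0 (Relation.trivial c (λ p → vanishes (suc (suc p)))
      (λ i bad → [ (λ { refl → trans (sym (δ-sum c i₀)) (vanishes zero) })
                 , (λ { refl → trans (sym (δ-sum c (π i₀))) (vanishes (suc zero)) }) ]′ (only i bad)) k)
    where
    δ : Fin L → Fin L → ℤ
    δ i j with i ≟ᶠ j
    ... | yes _ = 1ℤ
    ... | no  _ = 0ℤ
    extended : Fin L → Fin (suc (suc n)) → ℤ
    extended i zero          = δ i₀ i
    extended i (suc zero)    = δ (π i₀) i
    extended i (suc (suc p)) = X i p
    δ-sum : ∀ c i → ∑[ j < L ] (c j * δ i j) ≡ c i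
    δ-sum c i = trans (∑-single _ i off) on
      where
      off : ∀ j → j ≢ i → c j * δ i j ≡ 0ℤ
      off j j≢i with i ≟ᶠ j
      ... | yes i≡j = ⊥-elim (j≢i (sym i≡j))
      ... | no  _   = *-zeroʳ (c j)
      on : c i * δ i i ≡ c i
      on with i ≟ᶠ i
      ... | yes _  = ℤₚ.*-identityʳ (c i)
      ... | no i≢i = ⊥-elim (i≢i refl)

  -- The sum of the two members of a pair, or twice the member of a singleton block.
  blockSum : Fin L → Fin n → ℤ
  blockSum i p = X i p + X (π i) p

  -- A weighted average y / q, of squared length at most l, of the members of the block of i.
  -- If its squared length is l, then its values show how many members contain a point.
  record Centre (i : Fin L) : Set where
    field
      u v  : ℤ
      0<q  : 0ℤ < u + v
    q : ℤ
    q = u + v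
    y : Fin n → ℤ
    y p = u * X i p + v * X (π i) p
    field
      norm≤ : ⟨ y , y ⟩ ≤ l * (q * q)
      level : ⟨ y , y ⟩ ≡ l * (q * q) → ∀ p → Level q (y p) (blockSum i p)

  -- The average with the weights given by weight has squared length l + d / q, where d is
  -- the determinant of the block.
  centre : ∀ i → Bad i → Centre i
  centre i bad with π i ≟ᶠ i
  ... | yes πi≡i = record
    { u = 1ℤ ; v = 0ℤ ; 0<q = +<+ (ℕ.s≤s ℕ.z≤n)
    ; norm≤ = by-difference
        (trans (cong (λ x → l * (1ℤ * 1ℤ) - x) (⟨⟩-linear-sq 1ℤ 0ℤ (X i) (X (π i))))
          (solve 4 (λ l a g b → l :* con 1ℤ :- (con 1ℤ :* con 1ℤ :* a :+ con (+ 2) :* (con 1ℤ :* con 0ℤ) :* g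
                                 :+ con 0ℤ :* con 0ℤ :* b) := con 0ℤ :- (a :- l))
            refl l ⟨ X i , X i ⟩ ⟨ X i , X (π i) ⟩ ⟨ X (π i) , X (π i) ⟩))
        (i≤j⇒0≤j-i bad)
    ; level = λ _ p → single-level (bit i p) (cong (λ j → X j p) πi≡i)
    }
  ... | no πi≢i = record
    { u = b - g ; v = a - g ; 0<q = 0<q
    ; norm≤ = by-difference
        (trans (cong (λ x → l * (q * q) - x) norm)
          (solve 3 (λ l q d → l :* (q :* q) :- (l :* (q :* q) :+ q :* d) := q :* (con 0ℤ :- d)) refl l q d))
        (0≤* (<⇒≤ 0<q) (i≤j⇒0≤j-i bad))
    ; level = λ tight p → pair-level
        (≢0⇒0< (i≤j⇒0≤j-i (meet≤size i (π i))) (u≢0 tight))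
        (≢0⇒0< 0≤a-g (v≢0 tight)) (bit i p) (bit (π i) p)
    }
    where
    a = ⟨ X i , X i ⟩
    b = ⟨ X (π i) , X (π i) ⟩
    g = ⟨ X i , X (π i) ⟩
    q = (b - g) + (a - g)
    d = (a - l) * (b - l) - (g - l) * (g - l)
    y : Fin n → ℤ
    y p = (b - g) * X i p + (a - g) * X (π i) p

    0≤a-g : 0ℤ ≤ a - g
    0≤a-g = i≤j⇒0≤j-i (subst (_≤ a) (⟨⟩-comm (X (π i)) (X i)) (meet≤size (π i) i))

    -- q is the squared distance of the two members.
    difference : Fin n → ℤ
    difference p = 1ℤ * X i p + -1ℤ * X (π i) p
    distance : ⟨ difference , difference ⟩ ≡ q
    distance = trans (⟨⟩-linear-sq 1ℤ -1ℤ (X i) (X (π i)))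
      (solve 3 (λ a g b → con 1ℤ :* con 1ℤ :* a :+ con (+ 2) :* (con 1ℤ :* con -1ℤ) :* g
                 :+ con -1ℤ :* con -1ℤ :* b := (b :- g) :+ (a :- g)) refl a g b)

    0<q : 0ℤ < q
    0<q = ≰⇒> λ q≤0 → πi≢i (sym (injective i (π i) λ p →
      trans (solve 2 (λ x z → x := (con 1ℤ :* x :+ con -1ℤ :* z) :+ z) refl (X i p) (X (π i) p))
        (trans (cong (_+ X (π i) p) (⟨v,v⟩≤0⇒v≗0 difference (subst (_≤ 0ℤ) (sym distance) q≤0) p))
               (+-identityˡ _))))

    norm : ⟨ y , y ⟩ ≡ l * (q * q) + q * d
    norm = trans (⟨⟩-linear-sq (b - g) (a - g) (X i) (X (π i)))
      (solve 4 (λ l a g b → let u = b :- g ; v = a :- g ; q = u :+ v in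
          u :* u :* a :+ con (+ 2) :* (u :* v) :* g :+ v :* v :* b
          := l :* (q :* q) :+ q :* ((a :- l) :* (b :- l) :- (g :- l) :* (g :- l))) refl l a g b)

    module _ (tight : ⟨ y , y ⟩ ≡ l * (q * q)) where
      d≡0 : d ≡ 0ℤ
      d≡0 = *-pos≡0 0<q (trans
        (solve 2 (λ x z → z := (x :+ z) :- x) refl (l * (q * q)) (q * d))
        (trans (cong (_- l * (q * q)) (trans (sym norm) tight)) (ℤₚ.+-inverseʳ (l * (q * q)))))

      -- If one member contained the other, d = 0 would be the product of g - l and q.
      g-l≢0 : q * (g - l) ≢ 0ℤ
      g-l≢0 h = exception i πi≢i (ℤₚ.i-j≡0⇒i≡j g l (*-pos≡0 0<q h))

      u≢0 : b - g ≢ 0ℤ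
      u≢0 h = g-l≢0 (trans (solve 4 (λ l a g b →
          (b :- g :+ (a :- g)) :* (g :- l)
          := (a :- l) :* (b :- l) :- (g :- l) :* (g :- l)
             :- (b :- g) :* (a :- g)) refl l a g b)
        (cong₂ (λ x z → x - z * (a - g)) d≡0 h))

      v≢0 : a - g ≢ 0ℤ
      v≢0 h = g-l≢0 (trans (solve 4 (λ l a g b →
          (b :- g :+ (a :- g)) :* (g :- l)
          := (a :- l) :* (b :- l) :- (g :- l) :* (g :- l)
             :- (a :- g) :* (b :- g)) refl l a g b)
        (cong₂ (λ x z → x - z * (b - g)) d≡0 h))

  module TwoBadBlocks {i j : Fin L} (j≢i : j ≢ i) (j≢πi : j ≢ π i) (bi : Centre i) (bj : Centre j) where
    open Centre

    private
      qi = q bi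
      qj = q bj
      qi² = qi * qi
      qj² = qj * qj
      slack-i = l * qi² - ⟨ y bi , y bi ⟩
      slack-j = l * qj² - ⟨ y bj , y bj ⟩

      πj≢i : π j ≢ i
      πj≢i h = j≢πi (trans (sym (π-invol j)) (cong π h))
      πj≢πi : π j ≢ π i
      πj≢πi h = j≢i (trans (sym (π-invol j)) (trans (cong π h) (π-invol i)))

      ⟨y,X⟩ : ∀ k → k ≢ i → k ≢ π i → ⟨ y bi , X k ⟩ ≡ qi * l
      ⟨y,X⟩ k k≢i k≢πi = trans (⟨⟩-linear (u bi) (v bi) (X i) (X (π i)) (X k))
        (trans (cong₂ (λ s t → u bi * s + v bi * t) (meet i k k≢i k≢πi)
                 (meet (π i) k k≢πi λ h → k≢i (trans h (π-invol i))))
          (sym (ℤₚ.*-distribʳ-+ l (u bi) (v bi))))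

      ⟨y,y⟩ : ⟨ y bi , y bj ⟩ ≡ l * (qi * qj)
      ⟨y,y⟩ = begin
        ⟨ y bi , y bj ⟩  ≡⟨ ⟨⟩-comm (y bi) (y bj) ⟩
        ⟨ y bj , y bi ⟩  ≡⟨ ⟨⟩-linear (u bj) (v bj) (X j) (X (π j)) (y bi) ⟩
        u bj * ⟨ X j , y bi ⟩ + v bj * ⟨ X (π j) , y bi ⟩
          ≡⟨ cong₂ (λ s t → u bj * s + v bj * t)
               (trans (⟨⟩-comm (X j) (y bi)) (⟨y,X⟩ j j≢i j≢πi))
               (trans (⟨⟩-comm (X (π j)) (y bi)) (⟨y,X⟩ (π j) πj≢i πj≢πi)) ⟩
        u bj * (qi * l) + v bj * (qi * l)
          ≡⟨ solve 4 (λ u v q l → u :* (q :* l) :+ v :* (q :* l) := l :* (q :* (u :+ v)))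
               refl (u bj) (v bj) qi l ⟩
        l * (qi * qj) ∎
        where open ≡-Reasoning

      gap : Fin n → ℤ
      gap p = qj * y bi p + - qi * y bj p

      ⟨gap⟩ : ⟨ gap , gap ⟩ ≡ - (qj² * slack-i + qi² * slack-j)
      ⟨gap⟩ = trans (⟨⟩-linear-sq qj (- qi) (y bi) (y bj))
        (trans (cong (λ x → qj * qj * ⟨ y bi , y bi ⟩ + + 2 * (qj * - qi) * x
                            + - qi * - qi * ⟨ y bj , y bj ⟩) ⟨y,y⟩)
          (solve 5 (λ l q r s t → r :* r :* s :+ con (+ 2) :* (r :* (:- q)) :* (l :* (q :* r))
                                   :+ (:- q) :* (:- q) :* t
              := :- (r :* r :* (l :* (q :* q) :- s) :+ q :* q :* (l :* (r :* r) :- t)))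
            refl l qi qj ⟨ y bi , y bi ⟩ ⟨ y bj , y bj ⟩))

      0≤i : 0ℤ ≤ qj² * slack-i
      0≤i = 0≤* (0≤sq qj) (i≤j⇒0≤j-i (norm≤ bi))
      0≤j : 0ℤ ≤ qi² * slack-j
      0≤j = 0≤* (0≤sq qi) (i≤j⇒0≤j-i (norm≤ bj))

      ⟨gap⟩≤0 : ⟨ gap , gap ⟩ ≤ 0ℤ
      ⟨gap⟩≤0 = subst (_≤ 0ℤ) (sym ⟨gap⟩) (ℤₚ.neg-mono-≤ (0≤+ 0≤i 0≤j))

    -- The two averages have inner product l and squared length at most l, so they coincide;
    -- gap is their difference, multiplied by both denominators.
    proportional : ∀ p → qj * y bi p ≡ qi * y bj p
    proportional p = trans
      (solve 4 (λ r x q z → r :* x := (r :* x :+ (:- q) :* z) :+ q :* z) refl qj (y bi p) qi (y bj p))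
      (trans (cong (_+ qi * y bj p) (⟨v,v⟩≤0⇒v≗0 gap ⟨gap⟩≤0 p)) (+-identityˡ _))

    private
      slacks≡0 : qj² * slack-i + qi² * slack-j ≡ 0ℤ
      slacks≡0 = ℤₚ.neg-injective (trans (sym ⟨gap⟩) (≤-antisym ⟨gap⟩≤0 (0≤⟨v,v⟩ gap)))

    tightˡ : ⟨ y bi , y bi ⟩ ≡ l * qi²
    tightˡ = sym (ℤₚ.i-j≡0⇒i≡j _ _ (*-pos≡0 (0<q bj) (*-pos≡0 (0<q bj)
      (trans (sym (ℤₚ.*-assoc qj qj slack-i)) (0≤+≡0ˡ 0≤i 0≤j slacks≡0)))))
    tightʳ : ⟨ y bj , y bj ⟩ ≡ l * qj²
    tightʳ = sym (ℤₚ.i-j≡0⇒i≡j _ _ (*-pos≡0 (0<q bi) (*-pos≡0 (0<q bi)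
      (trans (sym (ℤₚ.*-assoc qi qi slack-j))
        (0≤+≡0ˡ 0≤j 0≤i (trans (ℤₚ.+-comm (qi² * slack-j) _) slacks≡0))))))

    blockSum-≗ : blockSum i ≗ blockSum j
    blockSum-≗ p = level-determined (0<q bi) (0<q bj)
      (level bi tightˡ p) (level bj tightʳ p) (proportional p)

  -- Counting around a common centre W / 2

  module Balanced
    (W : Fin n → ℤ) (W-level : ∀ p → W p ≡ 0ℤ ⊎ W p ≡ 1ℤ ⊎ W p ≡ + 2)
    (⟨X,W⟩ : ∀ k → ⟨ X k , W ⟩ ≡ + 2 * l) (⟨W,W⟩ : ⟨ W , W ⟩ ≡ + 4 * l) where

    -- The number of points p with W p = 1, as w (2 - w) is 0, 1, 0 for w = 0, 1, 2.
    N : ℤ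
    N = ∑[ p < n ] (W p * (+ 2 - W p))

    N≤4l : N ≤ + 4 * l
    N≤4l = subst (N ≤_) ⟨W,W⟩ (∑-mono λ p → pointwise (W-level p))
      where
      pointwise : ∀ {w} → w ≡ 0ℤ ⊎ w ≡ 1ℤ ⊎ w ≡ + 2 → w * (+ 2 - w) ≤ w * w
      pointwise (inj₁ refl)        = +≤+ ℕ.z≤n
      pointwise (inj₂ (inj₁ refl)) = ≤-refl
      pointwise (inj₂ (inj₂ refl)) = +≤+ ℕ.z≤n

    3N+4l≤4n : + 3 * N + + 4 * l ≤ + n * + 4
    3N+4l≤4n = subst₂ _≤_
      (trans (∑-linear (+ 3) 1ℤ (λ p → W p * (+ 2 - W p)) (λ p → W p * W p))
             (cong (_+_ (+ 3 * N)) (trans (*-identityˡ _) ⟨W,W⟩)))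
      (∑-const n (+ 4))
      (∑-mono λ p → pointwise (W-level p))
      where
      pointwise : ∀ {w} → w ≡ 0ℤ ⊎ w ≡ 1ℤ ⊎ w ≡ + 2 → + 3 * (w * (+ 2 - w)) + 1ℤ * (w * w) ≤ + 4
      pointwise (inj₁ refl)        = +≤+ ℕ.z≤n
      pointwise (inj₂ (inj₁ refl)) = ≤-refl
      pointwise (inj₂ (inj₂ refl)) = ≤-refl

    -- Twice the displacement of X k from the centre W / 2.
    V : Fin L → Fin n → ℤ
    V k p = + 2 * X k p + -1ℤ * W p

    ⟨V,V⟩ : ∀ j k → ⟨ V j , V k ⟩ ≡ + 4 * (⟨ X j , X k ⟩ - l)
    ⟨V,V⟩ j k = begin
      ⟨ V j , V k ⟩  ≡⟨ ⟨⟩-linear (+ 2) -1ℤ (X j) W (V k) ⟩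
      + 2 * ⟨ X j , V k ⟩ + -1ℤ * ⟨ W , V k ⟩
        ≡⟨ cong₂ (λ s t → + 2 * s + -1ℤ * t) (⟨w,V⟩ (X j)) (⟨w,V⟩ W) ⟩
      + 2 * (+ 2 * ⟨ X k , X j ⟩ + -1ℤ * ⟨ W , X j ⟩) + -1ℤ * (+ 2 * ⟨ X k , W ⟩ + -1ℤ * ⟨ W , W ⟩)
        ≡⟨ cong₂ (λ s t → + 2 * (+ 2 * s + -1ℤ * t) + -1ℤ * (+ 2 * ⟨ X k , W ⟩ + -1ℤ * ⟨ W , W ⟩))
             (⟨⟩-comm (X k) (X j)) (trans (⟨⟩-comm W (X j)) (⟨X,W⟩ j)) ⟩
      + 2 * (+ 2 * g + -1ℤ * (+ 2 * l)) + -1ℤ * (+ 2 * ⟨ X k , W ⟩ + -1ℤ * ⟨ W , W ⟩)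
        ≡⟨ cong₂ (λ s t → + 2 * (+ 2 * g + -1ℤ * (+ 2 * l)) + -1ℤ * (+ 2 * s + -1ℤ * t)) (⟨X,W⟩ k) ⟨W,W⟩ ⟩
      + 2 * (+ 2 * g + -1ℤ * (+ 2 * l)) + -1ℤ * (+ 2 * (+ 2 * l) + -1ℤ * (+ 4 * l))
        ≡⟨ solve 2 (λ g l → con (+ 2) :* (con (+ 2) :* g :+ con -1ℤ :* (con (+ 2) :* l))
             :+ con -1ℤ :* (con (+ 2) :* (con (+ 2) :* l) :+ con -1ℤ :* (con (+ 4) :* l))
             := con (+ 4) :* (g :- l)) refl g l ⟩
      + 4 * (g - l) ∎
      where
      open ≡-Reasoning
      g = ⟨ X j , X k ⟩
      ⟨w,V⟩ : ∀ w → ⟨ w , V k ⟩ ≡ + 2 * ⟨ X k , w ⟩ + -1ℤ * ⟨ W , w ⟩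
      ⟨w,V⟩ w = trans (⟨⟩-comm w (V k)) (⟨⟩-linear (+ 2) -1ℤ (X k) W w)

    -- Displacements of members that are not partners are orthogonal.
    orthogonal : ∀ i j → j ≢ i → j ≢ π i → ⟨ V j , V i ⟩ ≡ 0ℤ
    orthogonal i j j≢i j≢πi = trans (⟨⟩-comm (V j) (V i)) (trans (⟨V,V⟩ i j)
      (trans (cong (λ g → + 4 * (g - l)) (meet i j j≢i j≢πi))
        (solve 1 (λ l → con (+ 4) :* (l :- l) := con 0ℤ) refl l)))

    energy : ℤ
    energy = ∑[ i < L ] ⟨ V i , V i ⟩

    -- A signed sum of the V i has at most twice the squared length that it would have if all
    -- the V i were orthogonal, as each of them has at most one non-orthogonal partner.
    signed-sum : (θ : Fin L → ℤ) → (∀ i → θ i * θ i ≡ 1ℤ) →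
                 ⟨ combination θ V , combination θ V ⟩ ≤ + 2 * energy
    signed-sum θ θ²≡1 = cancel-positive {+ 2} (+<+ (ℕ.s≤s ℕ.z≤n)) (begin
      + 2 * ⟨ Σθ , Σθ ⟩
        ≡⟨ cong (+ 2 *_) (⟨combination⟩ θ V Σθ) ⟩
      + 2 * ∑[ i < L ] (θ i * ⟨ V i , Σθ ⟩)
        ≡⟨ *-distribˡ-sum (+ 2) (λ i → θ i * ⟨ V i , Σθ ⟩) ⟩
      ∑[ i < L ] (+ 2 * (θ i * ⟨ V i , Σθ ⟩))
        ≤⟨ ∑-mono row-bound ⟩
      ∑[ i < L ] (+ 3 * ⟨ V i , V i ⟩ + 1ℤ * ⟨ V (π i) , V (π i) ⟩)
        ≡⟨ ∑-linear (+ 3) 1ℤ (λ i → ⟨ V i , V i ⟩) (λ i → ⟨ V (π i) , V (π i) ⟩) ⟩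
      + 3 * energy + 1ℤ * ∑[ i < L ] ⟨ V (π i) , V (π i) ⟩
        ≡⟨ cong (λ x → + 3 * energy + 1ℤ * x)
             (sym (sum-permute (λ i → ⟨ V i , V i ⟩) (permutation π π π-invol π-invol))) ⟩
      + 3 * energy + 1ℤ * energy
        ≡⟨ solve 1 (λ h → con (+ 3) :* h :+ con 1ℤ :* h := con (+ 2) :* (con (+ 2) :* h)) refl energy ⟩
      + 2 * (+ 2 * energy) ∎)
      where
      open ℤₚ.≤-Reasoning
      Σθ = combination θ V

      inner : ∀ i → ⟨ V i , Σθ ⟩ ≡ ∑[ j < L ] (θ j * ⟨ V j , V i ⟩)
      inner i = trans (⟨⟩-comm (V i) Σθ) (⟨combination⟩ θ V (V i))

      off-block : ∀ i j → j ≢ i → j ≢ π i → θ j * ⟨ V j , V i ⟩ ≡ 0ℤ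
      off-block i j j≢i j≢πi = trans (cong (θ j *_) (orthogonal i j j≢i j≢πi)) (*-zeroʳ (θ j))

      row-bound : ∀ i → + 2 * (θ i * ⟨ V i , Σθ ⟩) ≤ + 3 * ⟨ V i , V i ⟩ + 1ℤ * ⟨ V (π i) , V (π i) ⟩
      row-bound i with π i ≟ᶠ i
      ... | yes πi≡i = by-difference
        (trans (cong (λ x → + 3 * a + 1ℤ * b - + 2 * (θ i * x)) (trans (inner i)
                 (∑-single _ i λ j j≢i → off-block i j j≢i λ j≡πi → j≢i (trans j≡πi πi≡i))))
          (trans (solve 3 (λ a b t → con (+ 3) :* a :+ con 1ℤ :* b :- con (+ 2) :* (t :* (t :* a))
                     := con (+ 3) :* a :+ b :- con (+ 2) :* (t :* t) :* a) refl a b (θ i))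
            (trans (cong (λ x → + 3 * a + b - + 2 * x * a) (θ²≡1 i))
              (solve 2 (λ a b → con (+ 3) :* a :+ b :- con (+ 2) :* con 1ℤ :* a := a :+ b) refl a b))))
        (0≤+ (0≤⟨v,v⟩ (V i)) (0≤⟨v,v⟩ (V (π i))))
        where
        a = ⟨ V i , V i ⟩
        b = ⟨ V (π i) , V (π i) ⟩
      ... | no πi≢i = by-difference
        (trans (cong (λ x → + 3 * a + 1ℤ * b - + 2 * (θ i * x)) (trans (inner i)
                 (trans (∑-pair _ i (π i) (πi≢i ∘ sym) (off-block i))
                   (cong (λ x → θ i * a + θ (π i) * x) (⟨⟩-comm (V (π i)) (V i))))))
          (trans (solve 5 (λ a b g s t → con (+ 3) :* a :+ con 1ℤ :* b :- con (+ 2) :* (s :* (s :* a :+ t :* g))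
                     := con (+ 3) :* a :+ b :- con (+ 3) :* (s :* s) :* a :- t :* t :* b
                        :+ (s :* s :* a :+ con (+ 2) :* (s :* (:- t)) :* g :+ (:- t) :* (:- t) :* b))
                   refl a b g (θ i) (θ (π i)))
            (trans (cong₂ (λ s t → + 3 * a + b - + 3 * s * a - t * b
                             + (θ i * θ i * a + + 2 * (θ i * - θ (π i)) * g + - θ (π i) * - θ (π i) * b))
                     (θ²≡1 i) (θ²≡1 (π i)))
              (trans (solve 3 (λ a b e → con (+ 3) :* a :+ b :- con (+ 3) :* con 1ℤ :* a :- con 1ℤ :* b :+ e := e)
                       refl a b (θ i * θ i * a + + 2 * (θ i * - θ (π i)) * g + - θ (π i) * - θ (π i) * b))
                (sym (⟨⟩-linear-sq (θ i) (- θ (π i)) (V i) (V (π i))))))))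
        (0≤⟨v,v⟩ (λ p → θ i * V i p + - θ (π i) * V (π i) p))
        where
        a = ⟨ V i , V i ⟩
        b = ⟨ V (π i) , V (π i) ⟩
        g = ⟨ V i , V (π i) ⟩

    V²-at-1 : ∀ {p} → W p ≡ 1ℤ → ∀ k → V k p * V k p ≡ 1ℤ
    V²-at-1 {p} W≡1 k = trans (cong (λ w → (+ 2 * X k p + -1ℤ * w) * (+ 2 * X k p + -1ℤ * w)) W≡1)
      (signs (bit k p))
      where
      signs : ∀ {x} → Bit x → (+ 2 * x + -1ℤ * 1ℤ) * (+ 2 * x + -1ℤ * 1ℤ) ≡ 1ℤ
      signs (inj₁ refl) = refl
      signs (inj₂ refl) = refl

    -- The sum of all V k with signs chosen to agree at a point p with W p = 1.
    L²≤2energy : ∀ {p} → W p ≡ 1ℤ → + L * + L ≤ + 2 * energy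
    L²≤2energy {p} W≡1 = ≤-trans
      (≤-reflexive (sym (cong₂ _*_ at-p at-p)))
      (≤-trans (term≤∑ _ (λ p → 0≤sq (combination θ V p)) p) (signed-sum θ (V²-at-1 W≡1)))
      where
      θ : Fin L → ℤ
      θ k = V k p
      at-p : combination θ V p ≡ + L
      at-p = trans (sum-cong-≗ (V²-at-1 W≡1)) (trans (∑-const L 1ℤ) (ℤₚ.*-identityʳ (+ L)))

    -- Where W p is 0 or 2, all V k p have the same sign and are 0 or 2 in absolute value, so
    -- that their sum of squares is up to sign twice their sum.
    -- The constant c is free in the inequality between 2 c P, with P the sum of squares at
    -- one point, and c squared plus P squared.
    energy-bound : ∀ c → + 2 * c * energy ≤ + 2 * c * + L * N + + n * (c * c) + + 8 * energy
    energy-bound c = begin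
      + 2 * c * energy
        ≡⟨ cong (+ 2 * c *_) (∑-comm (λ k p → V k p * V k p)) ⟩
      + 2 * c * ∑[ p < n ] P p
        ≡⟨ *-distribˡ-sum (+ 2 * c) P ⟩
      ∑[ p < n ] (+ 2 * c * P p)
        ≤⟨ ∑-mono (λ p → pointwise p (W-level p)) ⟩
      ∑[ p < n ] (1ℤ * (+ 2 * c * + L * (W p * (+ 2 - W p)) + 1ℤ * (c * c)) + + 4 * (K p * K p))
        ≡⟨ ∑-linear 1ℤ (+ 4) (λ p → + 2 * c * + L * (W p * (+ 2 - W p)) + 1ℤ * (c * c)) (λ p → K p * K p) ⟩
      1ℤ * ∑[ p < n ] (+ 2 * c * + L * (W p * (+ 2 - W p)) + 1ℤ * (c * c)) + + 4 * ⟨ K , K ⟩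
        ≡⟨ cong (λ x → 1ℤ * x + + 4 * ⟨ K , K ⟩)
             (trans (∑-linear (+ 2 * c * + L) 1ℤ (λ p → W p * (+ 2 - W p)) (λ _ → c * c))
               (cong (λ x → + 2 * c * + L * N + 1ℤ * x) (∑-const n (c * c)))) ⟩
      1ℤ * (+ 2 * c * + L * N + 1ℤ * (+ n * (c * c))) + + 4 * ⟨ K , K ⟩
        ≤⟨ +-mono-≤ (≤-refl {1ℤ * (+ 2 * c * + L * N + 1ℤ * (+ n * (c * c)))})
             (ℤₚ.*-monoˡ-≤-nonNeg (+ 4) (signed-sum (λ _ → 1ℤ) (λ _ → refl))) ⟩
      1ℤ * (+ 2 * c * + L * N + 1ℤ * (+ n * (c * c))) + + 4 * (+ 2 * energy)
        ≡⟨ solve 3 (λ x y h → con 1ℤ :* (x :+ con 1ℤ :* y) :+ con (+ 4) :* (con (+ 2) :* h)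
             := x :+ y :+ con (+ 8) :* h) refl (+ 2 * c * + L * N) (+ n * (c * c)) energy ⟩
      + 2 * c * + L * N + + n * (c * c) + + 8 * energy ∎
      where
      open ℤₚ.≤-Reasoning
      P K : Fin n → ℤ
      P p = ∑[ k < L ] (V k p * V k p)
      K = combination (λ _ → 1ℤ) V

      scaled : ∀ p s → (∀ k → V k p * V k p ≡ s * (1ℤ * V k p)) → P p ≡ s * K p
      scaled p s h = trans (sum-cong-≗ h) (sym (*-distribˡ-sum s (λ k → 1ℤ * V k p)))

      square-of : ∀ {w} p s → (∀ {x} → Bit x → let v = + 2 * x + -1ℤ * w in v * v ≡ s * (1ℤ * v)) →
                  W p ≡ w → ∀ k → V k p * V k p ≡ s * (1ℤ * V k p)
      square-of p s h refl k = h (bit k p)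

      pointwise : ∀ p → W p ≡ 0ℤ ⊎ W p ≡ 1ℤ ⊎ W p ≡ + 2 →
        + 2 * c * P p ≤ 1ℤ * (+ 2 * c * + L * (W p * (+ 2 - W p)) + 1ℤ * (c * c)) + + 4 * (K p * K p)
      pointwise p (inj₁ W≡0) = by-difference
        (trans (cong₂ (λ w x → 1ℤ * (+ 2 * c * + L * (w * (+ 2 - w)) + 1ℤ * (c * c)) + + 4 * (K p * K p) - + 2 * c * x)
                 W≡0 (scaled p (+ 2) (square-of p (+ 2) (λ { (inj₁ refl) → refl ; (inj₂ refl) → refl }) W≡0)))
          (solve 3 (λ c m k → con 1ℤ :* (con (+ 2) :* c :* m :* (con 0ℤ :* (con (+ 2) :- con 0ℤ)) :+ con 1ℤ :* (c :* c))
                       :+ con (+ 4) :* (k :* k) :- con (+ 2) :* c :* (con (+ 2) :* k)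
                     := (c :- con (+ 2) :* k) :* (c :- con (+ 2) :* k)) refl c (+ L) (K p)))
        (0≤sq (c - + 2 * K p))
      pointwise p (inj₂ (inj₁ W≡1)) = by-difference
        (trans (cong₂ (λ w x → 1ℤ * (+ 2 * c * + L * (w * (+ 2 - w)) + 1ℤ * (c * c)) + + 4 * (K p * K p) - + 2 * c * x)
                 W≡1 (trans (sum-cong-≗ (V²-at-1 W≡1)) (∑-const L 1ℤ)))
          (solve 3 (λ c m k → con 1ℤ :* (con (+ 2) :* c :* m :* (con 1ℤ :* (con (+ 2) :- con 1ℤ)) :+ con 1ℤ :* (c :* c))
                       :+ con (+ 4) :* (k :* k) :- con (+ 2) :* c :* (m :* con 1ℤ)
                     := c :* c :+ con (+ 4) :* (k :* k)) refl c (+ L) (K p)))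
        (0≤+ (0≤sq c) (0≤* {+ 4} (+≤+ ℕ.z≤n) (0≤sq (K p))))
      pointwise p (inj₂ (inj₂ W≡2)) = by-difference
        (trans (cong₂ (λ w x → 1ℤ * (+ 2 * c * + L * (w * (+ 2 - w)) + 1ℤ * (c * c)) + + 4 * (K p * K p) - + 2 * c * x)
                 W≡2 (scaled p (- + 2) (square-of p (- + 2) (λ { (inj₁ refl) → refl ; (inj₂ refl) → refl }) W≡2)))
          (solve 3 (λ c m k → con 1ℤ :* (con (+ 2) :* c :* m :* (con (+ 2) :* (con (+ 2) :- con (+ 2))) :+ con 1ℤ :* (c :* c))
                       :+ con (+ 4) :* (k :* k) :- con (+ 2) :* c :* (con (- + 2) :* k)
                     := (c :+ con (+ 2) :* k) :* (c :+ con (+ 2) :* k)) refl c (+ L) (K p)))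
        (0≤sq (c + + 2 * K p))

    -- Eliminating the energy from its two bounds, the second taken with c = 6 s + 8: as N is
    -- at most 4 l, this exceeds the square root of N by enough to make every coefficient of
    -- the difference below nonnegative.
    size-bound : ∀ {p} → W p ≡ 1ℤ → 0ℤ < + L → + n ≤ + L → ∀ s → 0ℤ ≤ s → l ≤ s * s →
                 + L ≤ + 2 * N + (+ 12 * s + + 16)
    size-bound W≡1 0<L n≤L s 0≤s l≤s² = cancel-positive 0<L (cancel-positive 0<12s+8 (by-difference
      (solve 6 (λ m h N n s l →
          let c = con (+ 6) :* s :+ con (+ 8) ; d = con (+ 12) :* s :+ con (+ 8) in
          d :* (m :* (con (+ 2) :* N :+ (con (+ 12) :* s :+ con (+ 16)))) :- d :* (m :* m)
          := d :* (con (+ 2) :* h :- m :* m)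
             :+ con (+ 2) :* (con (+ 2) :* c :* m :* N :+ n :* (c :* c) :+ con (+ 8) :* h :- con (+ 2) :* c :* h)
             :+ con (+ 2) :* (c :* c) :* (m :- n)
             :+ m :* (con (+ 16) :* (con (+ 4) :* l :- N) :+ con (+ 64) :* (s :* s :- l)
                      :+ con (+ 8) :* (s :* s) :+ con (+ 96) :* s))
        refl (+ L) energy N (+ n) s l)
      (0≤+ (0≤+ (0≤+
          (0≤* (<⇒≤ 0<12s+8) (i≤j⇒0≤j-i (L²≤2energy W≡1)))
          (0≤* {+ 2} (+≤+ ℕ.z≤n) (i≤j⇒0≤j-i (energy-bound (+ 6 * s + + 8)))))
          (0≤* (0≤* {+ 2} (+≤+ ℕ.z≤n) (0≤sq (+ 6 * s + + 8))) (i≤j⇒0≤j-i n≤L)))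
          (0≤* (<⇒≤ 0<L) (0≤+ (0≤+ (0≤+
            (0≤* {+ 16} (+≤+ ℕ.z≤n) (i≤j⇒0≤j-i N≤4l))
            (0≤* {+ 64} (+≤+ ℕ.z≤n) (i≤j⇒0≤j-i l≤s²)))
            (0≤* {+ 8} (+≤+ ℕ.z≤n) (0≤sq s)))
            (0≤* {+ 96} (+≤+ ℕ.z≤n) 0≤s))))))
      where
      0<12s+8 : 0ℤ < + 12 * s + + 8
      0<12s+8 = ℤₚ.+-mono-≤-< (0≤* {+ 12} (+≤+ ℕ.z≤n) 0≤s) (+<+ {0} {8} (ℕ.s≤s ℕ.z≤n))

  -- The dichotomy

  module CommonCentre {i j : Fin L} (j≢i : j ≢ i) (j≢πi : j ≢ π i)
                      (same : blockSum i ≗ blockSum j) where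

    ⟨blockSum⟩ : ∀ i w → ⟨ blockSum i , w ⟩ ≡ ⟨ X i , w ⟩ + ⟨ X (π i) , w ⟩
    ⟨blockSum⟩ i w = trans
      (sum-cong-≗ λ p → ℤₚ.*-distribʳ-+ (w p) (X i p) (X (π i) p))
      (∑-distrib-+ (λ p → X i p * w p) (λ p → X (π i) p * w p))

    outside-block : ∀ i k → k ≢ i → k ≢ π i → ⟨ X k , blockSum i ⟩ ≡ + 2 * l
    outside-block i k k≢i k≢πi = trans (⟨⟩-comm (X k) (blockSum i)) (trans (⟨blockSum⟩ i (X k))
      (trans (cong₂ _+_ (meet i k k≢i k≢πi) (meet (π i) k k≢πi λ h → k≢i (trans h (π-invol i))))
        (solve 1 (λ l → l :+ l := con (+ 2) :* l) refl l)))

    ⟨X,blockSum⟩ : ∀ k → ⟨ X k , blockSum i ⟩ ≡ + 2 * l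
    ⟨X,blockSum⟩ k with k ≟ᶠ i | k ≟ᶠ π i
    ... | no k≢i  | no k≢πi = outside-block i k k≢i k≢πi
    ... | yes refl | _ = trans (sum-cong-≗ λ p → cong (X i p *_) (same p))
      (outside-block j i (j≢i ∘ sym) λ h → j≢πi (trans (sym (π-invol j)) (cong π (sym h))))
    ... | no _ | yes refl = trans (sum-cong-≗ λ p → cong (X (π i) p *_) (same p))
      (outside-block j (π i) (j≢πi ∘ sym) λ h →
        j≢i (trans (sym (π-invol j)) (trans (cong π (sym h)) (π-invol i))))

    blockSum-level : ∀ p → blockSum i p ≡ 0ℤ ⊎ blockSum i p ≡ 1ℤ ⊎ blockSum i p ≡ + 2
    blockSum-level p = sums (bit i p) (bit (π i) p)
      where
      sums : ∀ {x z} → Bit x → Bit z → x + z ≡ 0ℤ ⊎ x + z ≡ 1ℤ ⊎ x + z ≡ + 2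
      sums (inj₁ refl) (inj₁ refl) = inj₁ refl
      sums (inj₁ refl) (inj₂ refl) = inj₂ (inj₁ refl)
      sums (inj₂ refl) (inj₁ refl) = inj₂ (inj₁ refl)
      sums (inj₂ refl) (inj₂ refl) = inj₂ (inj₂ refl)

    ⟨blockSum,blockSum⟩ : ⟨ blockSum i , blockSum i ⟩ ≡ + 4 * l
    ⟨blockSum,blockSum⟩ = trans (⟨blockSum⟩ i (blockSum i))
      (trans (cong₂ _+_ (⟨X,blockSum⟩ i) (⟨X,blockSum⟩ (π i)))
        (solve 1 (λ l → con (+ 2) :* l :+ con (+ 2) :* l := con (+ 4) :* l) refl l))

    -- Otherwise both blocks would be singletons, with the same member.
    split-point : ∃[ p ] blockSum i p ≡ 1ℤ
    split-point with any? (λ p → blockSum i p ℤₚ.≟ 1ℤ)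
    ... | yes found = found
    ... | no none = ⊥-elim (j≢i (sym (injective i j λ p →
      agree (bit i p) (bit (π i) p) (bit j p) (bit (π j) p) (λ h → none (p , h)) (same p))))
      where
      agree : ∀ {a b c d} → Bit a → Bit b → Bit c → Bit d → a + b ≢ 1ℤ → a + b ≡ c + d → a ≡ c
      agree (inj₁ refl) _           (inj₁ refl) _           _  _  = refl
      agree (inj₂ refl) _           (inj₂ refl) _           _  _  = refl
      agree (inj₁ refl) (inj₂ refl) (inj₂ refl) _           ≢1 _  = ⊥-elim (≢1 refl)
      agree (inj₁ refl) (inj₁ refl) (inj₂ refl) (inj₁ refl) _  ()
      agree (inj₁ refl) (inj₁ refl) (inj₂ refl) (inj₂ refl) _  ()
      agree (inj₂ refl) (inj₁ refl) (inj₁ refl) _           ≢1 _  = ⊥-elim (≢1 refl)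
      agree (inj₂ refl) (inj₂ refl) (inj₁ refl) (inj₁ refl) _  ()
      agree (inj₂ refl) (inj₂ refl) (inj₁ refl) (inj₂ refl) _  ()

    open Balanced (blockSum i) blockSum-level ⟨X,blockSum⟩ ⟨blockSum,blockSum⟩ public

  -- The conclusion from two blocks that are not positive definite.  The name refers to the
  -- displacements V k, which on the N points are sign vectors close to orthogonal.
  NearHadamard : Set
  NearHadamard = ∃[ N ] N ≤ + 4 * l × + 3 * N + + 4 * l ≤ + n * + 4 ×
    (∀ s → 0ℤ ≤ s → l ≤ s * s → + L ≤ + 2 * N + (+ 12 * s + + 16))

  paired-size : L ℕ.≤ suc (suc n) ⊎ NearHadamard
  paired-size with L ℕₚ.≤? suc (suc n)
  ... | yes small = inj₁ small
  ... | no large with any? (λ i → det i ≤? 0ℤ)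
  ...   | no none = inj₁ (one-bad-block (fromℕ< (ℕₚ.<-≤-trans ℕ.z<s (ℕₚ.≰⇒> large))) λ i bad →
            ⊥-elim (none (i , bad)))
  ...   | yes (i , bad-i) with any? (λ j → (det j ≤? 0ℤ) ×-dec (¬? (j ≟ᶠ i) ×-dec ¬? (j ≟ᶠ π i)))
  ...     | yes (j , bad-j , j≢i , j≢πi) = inj₂ (N , N≤4l , 3N+4l≤4n ,
              size-bound (proj₂ split-point) (+<+ (ℕₚ.<-≤-trans ℕ.z<s (ℕₚ.≰⇒> large)))
                (+≤+ (ℕₚ.≤-trans (ℕₚ.m≤n+m n 3) (ℕₚ.≰⇒> large))))
            where
            open CommonCentre j≢i j≢πi
              (TwoBadBlocks.blockSum-≗ j≢i j≢πi (centre i bad-i) (centre j bad-j))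
  ...     | no none = inj₁ (one-bad-block i only)
            where
            only : ∀ j → Bad j → j ≡ i ⊎ j ≡ π i
            only j bad-j with j ≟ᶠ i | j ≟ᶠ π i
            ... | yes j≡i | _        = inj₁ j≡i
            ... | no _    | yes j≡πi = inj₂ j≡πi
            ... | no j≢i  | no j≢πi  = ⊥-elim (none (j , bad-j , j≢i , j≢πi))

-- From almost Fisher families to characteristic vectors

bitOf : Bool → ℤ
bitOf true  = 1ℤ
bitOf false = 0ℤ

-- The characteristic vector of a subset.
χ : ∀ {n} → Subset n → Fin n → ℤ
χ F p = bitOf (Vec.lookup F p)

χ-bit : ∀ {n} (F : Subset n) p → Bit (χ F p)
χ-bit F p with Vec.lookup F p
... | true  = inj₂ refl
... | false = inj₁ refl

χ-injective : ∀ {n} (F G : Subset n) → χ F ≗ χ G → F ≡ G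
χ-injective []          []          h = refl
χ-injective (true  ∷ F) (true  ∷ G) h = cong (true  ∷_) (χ-injective F G (h ∘ suc))
χ-injective (false ∷ F) (false ∷ G) h = cong (false ∷_) (χ-injective F G (h ∘ suc))
χ-injective (true  ∷ F) (false ∷ G) h with () ← h zero
χ-injective (false ∷ F) (true  ∷ G) h with () ← h zero

⟨χ,χ⟩ : ∀ {n} (F G : Subset n) → ⟨ χ F , χ G ⟩ ≡ + ∣ F ∩ G ∣
⟨χ,χ⟩ []          []          = refl
⟨χ,χ⟩ (true  ∷ F) (true  ∷ G) = cong (_+_ 1ℤ) (⟨χ,χ⟩ F G)
⟨χ,χ⟩ (true  ∷ F) (false ∷ G) = trans (+-identityˡ _) (⟨χ,χ⟩ F G)
⟨χ,χ⟩ (false ∷ F) (true  ∷ G) = trans (+-identityˡ _) (⟨χ,χ⟩ F G)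
⟨χ,χ⟩ (false ∷ F) (false ∷ G) = trans (+-identityˡ _) (⟨χ,χ⟩ F G)

lookup-injective : ∀ {A : Set} {xs : List A} → Unique xs → ∀ i j → lookup xs i ≡ lookup xs j → i ≡ j
lookup-injective (_ ∷ u)  zero    zero    h = refl
lookup-injective (x∉ ∷ _) zero    (suc j) h = ⊥-elim (All.lookup x∉ (∈-lookup j) h)
lookup-injective (x∉ ∷ _) (suc i) zero    h = ⊥-elim (All.lookup x∉ (∈-lookup i) (sym h))
lookup-injective (_ ∷ u)  (suc i) (suc j) h = cong suc (lookup-injective u i j h)

atMostOne : ∀ {A : Set} {P : A → Set} (P? : Decidable P) xs → length (filter P? xs) ℕ.≤ 1 →
            ∀ i j → P (lookup xs i) → P (lookup xs j) → i ≡ j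
atMostOne {P = P} P? (x ∷ xs) h = cases
  where
  none : P x → ∀ k → ¬ P (lookup xs k)
  none px k pk with P? x
  ... | yes _  = ℕₚ.n≮0 (ℕₚ.<-≤-trans (filter-some P? (lose (∈-lookup {xs = xs} k) pk)) (ℕ.s≤s⁻¹ h))
  ... | no ¬px = ¬px px
  tail-bound : length (filter P? xs) ℕ.≤ 1
  tail-bound with P? x
  ... | yes _ = ℕₚ.≤-trans (ℕ.s≤s⁻¹ h) ℕ.z≤n
  ... | no _  = h
  cases : ∀ i j → P (lookup (x ∷ xs) i) → P (lookup (x ∷ xs) j) → i ≡ j
  cases zero    zero    _  _  = refl
  cases zero    (suc j) px pj = ⊥-elim (none px j pj)
  cases (suc i) zero    pi px = ⊥-elim (none px i pi)
  cases (suc i) (suc j) pi pj = cong suc (atMostOne P? xs tail-bound i j pi pj)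

-- The members of a 1-almost l-Fisher family, paired up by their exceptions.
paired : ∀ {n l} (𝓕 : Family n) → AlmostFisher 1 l (members 𝓕) → Paired n (card 𝓕) (+ l)
paired {n} {l} 𝓕 fisher = record
  { X         = χ ∘ F
  ; bit       = λ i → χ-bit (F i)
  ; injective = λ i j h → F-injective i j (χ-injective (F i) (F j) h)
  ; π         = π
  ; π-invol   = π-invol
  ; meet      = λ i j j≢i j≢πi → trans (⟨χ,χ⟩ (F i) (F j)) (cong +_ (decidable-stable (_ ℕₚ.≟ l)
      λ ≢l → j≢πi (sym (π-unique i j ((λ h → j≢i (F-injective j i h)) , ≢l)))))
  ; exception = λ i πi≢i h → proj₂ (π-exceptional i πi≢i)
      (ℤₚ.+-injective (trans (sym (⟨χ,χ⟩ (F i) (F (π i)))) h))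
  ; 0≤l       = +≤+ ℕ.z≤n
  }
  where
  F : Fin (card 𝓕) → Subset n
  F = lookup (members 𝓕)

  F-injective : ∀ i j → F i ≡ F j → i ≡ j
  F-injective = lookup-injective (distinct 𝓕)

  partner : ∀ i → Dec (∃[ j ] Exception l (F i) (F j))
  partner i = any? (λ j → exception? l (F i) (F j))

  π : Fin (card 𝓕) → Fin (card 𝓕)
  π i with partner i
  ... | yes (j , _) = j
  ... | no  _       = i

  π-exceptional : ∀ i → π i ≢ i → Exception l (F i) (F (π i))
  π-exceptional i πi≢i with partner i
  ... | yes (_ , e) = e
  ... | no  _       = ⊥-elim (πi≢i refl)

  π-unique : ∀ i j → Exception l (F i) (F j) → π i ≡ j
  π-unique i j e with partner i
  ... | yes (k , e′) = atMostOne (exception? l (F i)) (members 𝓕)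
                         (All.lookup fisher (∈-lookup i)) k j e′ e
  ... | no none      = ⊥-elim (none (j , e))

  Exception-sym : ∀ {G H : Subset n} → Exception l G H → Exception l H G
  Exception-sym {G} {H} (H≢G , ≢l) = H≢G ∘ sym , λ h → ≢l (trans (cong ∣_∣ (∩-comm G H)) h)

  π-invol : ∀ i → π (π i) ≡ i
  π-invol i with π i ≟ᶠ i
  ... | yes πi≡i = trans (cong π πi≡i) πi≡i
  ... | no  πi≢i = π-unique (π i) i (Exception-sym (π-exceptional i πi≢i))

-- The error term

-- The least r whose square is at least l; passing from l to l + 1 raises it by at most one.
ceil-sqrt : ℕ → ℕ
ceil-sqrt zero    = 0
ceil-sqrt (suc l) with suc l ℕₚ.≤? ceil-sqrt l ℕ.* ceil-sqrt l
... | yes _ = ceil-sqrt l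
... | no  _ = suc (ceil-sqrt l)

ceil-sqrt-lower : ∀ l → l ℕ.≤ ceil-sqrt l ℕ.* ceil-sqrt l
ceil-sqrt-lower zero    = ℕ.z≤n
ceil-sqrt-lower (suc l) with suc l ℕₚ.≤? ceil-sqrt l ℕ.* ceil-sqrt l
... | yes h = h
... | no  _ = ℕ.s≤s (ℕₚ.≤-trans (ceil-sqrt-lower l)
  (ℕₚ.≤-trans (ℕₚ.*-monoʳ-≤ (ceil-sqrt l) (ℕₚ.n≤1+n _)) (ℕₚ.m≤n+m _ (ceil-sqrt l))))

ceil-sqrt-upper : ∀ l → ceil-sqrt l ℕ.* ceil-sqrt l ℕ.≤ l ℕ.+ 2 ℕ.* ceil-sqrt l
ceil-sqrt-upper zero    = ℕ.z≤n
ceil-sqrt-upper (suc l) with suc l ℕₚ.≤? ceil-sqrt l ℕ.* ceil-sqrt l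
... | yes _ = ℕₚ.m≤n⇒m≤1+n (ceil-sqrt-upper l)
... | no ¬h = begin
  suc r ℕ.* suc r                   ≡⟨ ℕ-solver.solve 1 (λ r → (con′ 1 ⊕ r) ⊗ (con′ 1 ⊕ r)
                                         ⊜ r ⊗ r ⊕ (con′ 1 ⊕ con′ 2 ⊗ r)) refl r ⟩
  r ℕ.* r ℕ.+ (1 ℕ.+ 2 ℕ.* r)       ≤⟨ ℕₚ.+-mono-≤ (ℕ.s≤s⁻¹ (ℕₚ.≰⇒> ¬h)) (ℕₚ.+-monoˡ-≤ (2 ℕ.* r) (ℕ.s≤s (ℕ.z≤n {2}))) ⟩
  l ℕ.+ (3 ℕ.+ 2 ℕ.* r)             ≡⟨ ℕ-solver.solve 2 (λ l r → l ⊕ (con′ 3 ⊕ con′ 2 ⊗ r)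
                                         ⊜ con′ 1 ⊕ l ⊕ con′ 2 ⊗ (con′ 1 ⊕ r)) refl l r ⟩
  suc l ℕ.+ 2 ℕ.* suc r ∎
  where
  open ℕₚ.≤-Reasoning
  r = ceil-sqrt l

-- 12 s + 16, where s is the square root of l rounded up.
error : ℕ → ℕ
error l = 12 ℕ.* ceil-sqrt l ℕ.+ 16

-- For l at least (28 k + 3) squared, s is at least 28 k + 2, and l is at least (s - 2) s.
error-small : ∀ k l → (28 ℕ.* k ℕ.+ 3) ℕ.* (28 ℕ.* k ℕ.+ 3) ℕ.≤ l → k ℕ.* error l ℕ.≤ l
error-small k l large = ℕₚ.+-cancelʳ-≤ (2 ℕ.* s) _ _ (begin
  k ℕ.* (12 ℕ.* s ℕ.+ 16) ℕ.+ 2 ℕ.* s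
    ≤⟨ ℕₚ.+-monoˡ-≤ (2 ℕ.* s) (ℕₚ.*-monoʳ-≤ k (ℕₚ.+-monoʳ-≤ (12 ℕ.* s) (ℕₚ.*-monoʳ-≤ 16 1≤s))) ⟩
  k ℕ.* (12 ℕ.* s ℕ.+ 16 ℕ.* s) ℕ.+ 2 ℕ.* s
    ≡⟨ ℕ-solver.solve 2 (λ k s → k ⊗ (con′ 12 ⊗ s ⊕ con′ 16 ⊗ s) ⊕ con′ 2 ⊗ s
         ⊜ (con′ 28 ⊗ k ⊕ con′ 2) ⊗ s) refl k s ⟩
  (28 ℕ.* k ℕ.+ 2) ℕ.* s
    ≤⟨ ℕₚ.*-monoˡ-≤ s (ℕₚ.≤-trans (ℕₚ.+-monoʳ-≤ (28 ℕ.* k) (ℕₚ.n≤1+n 2)) K≤s) ⟩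
  s ℕ.* s
    ≤⟨ ceil-sqrt-upper l ⟩
  l ℕ.+ 2 ℕ.* s ∎)
  where
  open ℕₚ.≤-Reasoning
  s = ceil-sqrt l
  K = 28 ℕ.* k ℕ.+ 3
  K≤s : K ℕ.≤ s
  K≤s = ℕₚ.≮⇒≥ λ s<K → ℕₚ.<⇒≱ (ℕₚ.*-mono-< s<K s<K) (ℕₚ.≤-trans large (ceil-sqrt-lower l))
  1≤s : 1 ℕ.≤ s
  1≤s = ℕₚ.≤-trans (ℕₚ.m≤n+m 1 _) (ℕₚ.≤-trans (ℕₚ.+-monoʳ-≤ (28 ℕ.* k) (ℕ.s≤s (ℕ.z≤n {2}))) K≤s)

-- Comparison and arithmetic of fractions

/-mono : ∀ p a q b → p * + suc b ≤ q * + suc a → p / suc a ℚ.≤ q / suc b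
/-mono p a q b h = ℚₚ.toℚᵘ-cancel-≤ (begin
  ℚ.toℚᵘ (p / suc a)  ≃⟨ ℚₚ.toℚᵘ-fromℚᵘ (mkℚᵘ p a) ⟩
  mkℚᵘ p a            ≤⟨ ℚᵘ.*≤* h ⟩
  mkℚᵘ q b            ≃⟨ ℚₚ.toℚᵘ-fromℚᵘ (mkℚᵘ q b) ⟨
  ℚ.toℚᵘ (q / suc b)  ∎)
  where open ℚᵘₚ.≤-Reasoning

fromℚᵘ-+ : ∀ p q → ℚ.fromℚᵘ p ℚ.+ ℚ.fromℚᵘ q ≡ ℚ.fromℚᵘ (p ℚᵘ.+ q)
fromℚᵘ-+ p q = ℚₚ.toℚᵘ-injective (begin
  ℚ.toℚᵘ (ℚ.fromℚᵘ p ℚ.+ ℚ.fromℚᵘ q)                ≈⟨ ℚₚ.toℚᵘ-homo-+ (ℚ.fromℚᵘ p) (ℚ.fromℚᵘ q) ⟩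
  ℚ.toℚᵘ (ℚ.fromℚᵘ p) ℚᵘ.+ ℚ.toℚᵘ (ℚ.fromℚᵘ q)      ≈⟨ ℚᵘₚ.+-cong (ℚₚ.toℚᵘ-fromℚᵘ p) (ℚₚ.toℚᵘ-fromℚᵘ q) ⟩
  p ℚᵘ.+ q                                          ≈⟨ ℚₚ.toℚᵘ-fromℚᵘ (p ℚᵘ.+ q) ⟨
  ℚ.toℚᵘ (ℚ.fromℚᵘ (p ℚᵘ.+ q))                      ∎)
  where open import Relation.Binary.Reasoning.Setoid ℚᵘₚ.≃-setoid

fromℚᵘ-* : ∀ p q → ℚ.fromℚᵘ p ℚ.* ℚ.fromℚᵘ q ≡ ℚ.fromℚᵘ (p ℚᵘ.* q)
fromℚᵘ-* p q = ℚₚ.toℚᵘ-injective (begin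
  ℚ.toℚᵘ (ℚ.fromℚᵘ p ℚ.* ℚ.fromℚᵘ q)                ≈⟨ ℚₚ.toℚᵘ-homo-* (ℚ.fromℚᵘ p) (ℚ.fromℚᵘ q) ⟩
  ℚ.toℚᵘ (ℚ.fromℚᵘ p) ℚᵘ.* ℚ.toℚᵘ (ℚ.fromℚᵘ q)      ≈⟨ ℚᵘₚ.*-cong (ℚₚ.toℚᵘ-fromℚᵘ p) (ℚₚ.toℚᵘ-fromℚᵘ q) ⟩
  p ℚᵘ.* q                                          ≈⟨ ℚₚ.toℚᵘ-fromℚᵘ (p ℚᵘ.* q) ⟨
  ℚ.toℚᵘ (ℚ.fromℚᵘ (p ℚᵘ.* q))                      ∎)
  where open import Relation.Binary.Reasoning.Setoid ℚᵘₚ.≃-setoid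

fromℕ-mono : ∀ {a b} → a ℕ.≤ b → fromℕ a ℚ.≤ fromℕ b
fromℕ-mono {a} {b} h = /-mono (+ a) 0 (+ b) 0 (ℤₚ.*-monoʳ-≤-nonNeg 1ℤ (+≤+ h))

p≤p+ε : ∀ {p ε} → ℚ.0ℚ ℚ.< ε → p ℚ.≤ p ℚ.+ ε
p≤p+ε {p} 0<ε = subst (ℚ._≤ p ℚ.+ _) (ℚₚ.+-identityʳ p) (ℚₚ.+-monoʳ-≤ p (ℚₚ.<⇒≤ 0<ε))

-- The bound in the real numbers

remainder : ℕ → ℝ
remainder l = fromℚ (fromℕ (error l))

remainder-littleO : remainder isLittleOOfArgument
remainder-littleO ε 0<ε = (28 ℕ.* k ℕ.+ 3) ℕ.* (28 ℕ.* k ℕ.+ 3) , λ l large δ 0<δ →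
  0 , λ _ _ → ℚₚ.≤-trans (ℚₚ.⊔-lub (below l large)
    (ℚₚ.≤-trans (ℚₚ.neg-antimono-≤ (fromℕ-mono (ℕ.z≤n {error l})))
      (ℚₚ.≤-trans (fromℕ-mono (ℕ.z≤n {error l})) (below l large)))) (p≤p+ε 0<δ)
  where
  -- ε is at least 1 / k.
  k : ℕ
  k = ℚ.↧ₙ ε
  1≤num : 1ℤ ≤ ℚ.↥ ε
  1≤num = positive-numerator ε 0<ε
    where
    positive-numerator : ∀ ε → ℚ.0ℚ ℚ.< ε → 1ℤ ≤ ℚ.↥ ε
    positive-numerator (ℚ.mkℚ (+ suc a) _ _) _ = +≤+ (ℕ.s≤s ℕ.z≤n)
    positive-numerator (ℚ.mkℚ (+ zero)  _ _) (ℚ.*<* (+<+ ()))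
    positive-numerator (ℚ.mkℚ -[1+ _ ]  _ _) (ℚ.*<* ())
  below : ∀ l → (28 ℕ.* k ℕ.+ 3) ℕ.* (28 ℕ.* k ℕ.+ 3) ℕ.≤ l → fromℕ (error l) ℚ.≤ ε ℚ.* fromℕ l
  below l large = subst (fromℕ (error l) ℚ.≤_)
    (trans (sym (fromℚᵘ-* (mkℚᵘ (ℚ.↥ ε) (ℚ.ℚ.denominator-1 ε)) (mkℚᵘ (+ l) 0)))
           (cong (ℚ._* fromℕ l) (ℚₚ.↥p/↧p≡p ε)))
    (/-mono (+ error l) 0 (ℚ.↥ ε * + l) _ (begin
      + error l * + (k ℕ.* 1)  ≡⟨ cong (λ x → + error l * + x) (ℕₚ.*-identityʳ k) ⟩
      + error l * + k          ≡⟨ trans (*-comm (+ error l) (+ k)) (sym (pos-* k (error l))) ⟩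
      + (k ℕ.* error l)        ≤⟨ +≤+ (error-small k l large) ⟩
      + l                      ≡⟨ sym (*-identityˡ (+ l)) ⟩
      1ℤ * + l                 ≤⟨ ℤₚ.*-monoʳ-≤-nonNeg (+ l) 1≤num ⟩
      ℚ.↥ ε * + l              ≡⟨ sym (ℤₚ.*-identityʳ _) ⟩
      ℚ.↥ ε * + l * 1ℤ         ∎))
    where open ℤₚ.≤-Reasoning

-- The bound for near-Hadamard families, as an inequality of rationals.
near-hadamard-bound : ∀ {n l m N} → N ≤ + 4 * + l → + 3 * N + + 4 * + l ≤ + n * + 4 →
  + m ≤ + 2 * N + + error l →
  fromℕ m ℚ.≤ fromℕ 8 ℚ.* (fromℕ l ℚ.⊓ ((+ n - + l) / 3)) ℚ.+ fromℕ (error l)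
near-hadamard-bound {n} {l} {m} {N} N≤4l 3N+4l≤4n m≤ = begin
  + m / 1
    ≤⟨ /-mono (+ m) 0 (+ 2 * N + + error l) 0 (ℤₚ.*-monoʳ-≤-nonNeg 1ℤ m≤) ⟩
  (+ 2 * N + + error l) / 1
    ≡⟨ ℚₚ.fromℚᵘ-cong {mkℚᵘ (+ 2 * N + + error l) 0} {mkℚᵘ (+ 8) 0 ℚᵘ.* mkℚᵘ N 3 ℚᵘ.+ mkℚᵘ (+ error l) 0} (ℚᵘ.*≡* (solve 2 (λ N e →
         (con (+ 2) :* N :+ e) :* con (+ 4) := (con (+ 8) :* N :* con 1ℤ :+ e :* con (+ 4)) :* con 1ℤ)
         refl N (+ error l))) ⟩
  ℚ.fromℚᵘ (mkℚᵘ (+ 8) 0 ℚᵘ.* mkℚᵘ N 3 ℚᵘ.+ mkℚᵘ (+ error l) 0)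
    ≡⟨ sym (trans (cong (ℚ._+ fromℕ (error l)) (fromℚᵘ-* (mkℚᵘ (+ 8) 0) (mkℚᵘ N 3)))
         (fromℚᵘ-+ (mkℚᵘ (+ 8) 0 ℚᵘ.* mkℚᵘ N 3) (mkℚᵘ (+ error l) 0))) ⟩
  fromℕ 8 ℚ.* (N / 4) ℚ.+ fromℕ (error l)
    ≤⟨ ℚₚ.+-monoˡ-≤ (fromℕ (error l)) (ℚₚ.*-monoˡ-≤-nonNeg (fromℕ 8) (ℚₚ.⊓-glb
         (/-mono N 3 (+ l) 0 (≤-trans (≤-reflexive (ℤₚ.*-identityʳ N))
           (≤-trans N≤4l (≤-reflexive (*-comm (+ 4) (+ l))))))
         (/-mono N 3 (+ n - + l) 2 (by-difference
           (solve 3 (λ n l N → (n :- l) :* con (+ 4) :- N :* con (+ 3)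
              := n :* con (+ 4) :- (con (+ 3) :* N :+ con (+ 4) :* l)) refl (+ n) (+ l) N)
           (i≤j⇒0≤j-i 3N+4l≤4n))))) ⟩
  fromℕ 8 ℚ.* (fromℕ l ℚ.⊓ ((+ n - + l) / 3)) ℚ.+ fromℕ (error l) ∎
  where open ℚₚ.≤-Reasoning

family-bound : ∀ n l {m} → IsFisherSize n 1 l m → fromℕ m ℚ.≤
  fromℕ (n ℕ.+ 2) ℚ.⊔ (fromℕ 8 ℚ.* (fromℕ l ℚ.⊓ ((+ n - + l) / 3)) ℚ.+ fromℕ (error l))
family-bound n l (𝓕 , fisher , refl) = [ few , many ]′ (paired-size (paired 𝓕 fisher))
  where
  s = ceil-sqrt l
  few : card 𝓕 ℕ.≤ 2 ℕ.+ n → _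
  few small = ℚₚ.≤-trans (fromℕ-mono (subst (card 𝓕 ℕ.≤_) (ℕₚ.+-comm 2 n) small)) (ℚₚ.p≤p⊔q _ _)
  many : NearHadamard (paired 𝓕 fisher) → _
  many (N , N≤4l , 3N+4l≤4n , size) = ℚₚ.≤-trans
    (near-hadamard-bound {n} {l} N≤4l 3N+4l≤4n
      (subst (λ e → + card 𝓕 ≤ + 2 * N + e) (cong (_+ + 16) (sym (pos-* 12 s)))
        (size (+ s) (+≤+ ℕ.z≤n) (subst (+ l ≤_) (pos-* s s) (+≤+ (ceil-sqrt-lower l))))))
    (ℚₚ.p≤q⊔p (fromℕ (n ℕ.+ 2)) _)

theorem1p5 : ∃ λ (g : ℕ → ℝ) →
    g isLittleOOfArgument ×
    (∀ n l → 1 ℕ.≤ n →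
    fromℚ (fromℕ (f n 1 l)) ≤ℝ
    (fromℚ (fromℕ (n ℕ.+ 2))
    ⊔ℝ (fromℚ (fromℕ 8 ℚ.* (fromℕ l ℚ.⊓ ((+ n ℤ.- + l) / 3))) +ℝ g l)))
theorem1p5 = remainder , remainder-littleO , λ n l _ ε 0<ε →
  0 , λ _ _ → ℚₚ.≤-trans (family-bound n l (proj₁ (f-isMaximum n 1 l))) (p≤p+ε 0<ε)
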